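{- Let $n\ge 1$ be an integer, let $p$ be a prime, and let $P_n=\left(\binom{i-1}{j-1}\right)_{1\le i,j\le n}$ be the $n\times n$ lower triangular Pascal matrix. Then the Jordan form of $P_n$ mod $p$ (that is, of $P_n$ regarded as a matrix over the field $\mathbb{F}_p$) has precisely $\lceil n/p\rceil$ Jordan blocks, all corresponding to the eigenvalue $1$, and $\lfloor n/p\rfloor$ of them are of size $p$.
   Context: A binomial coefficient $\binom{a}{b}$ with integers $0\le a<b$ is zero, so $P_n$ is lower triangular with ones on the diagonal. A Jordan block of size $m$ with eigenvalue $\lambda$ is here the $m\times m$ matrix with $\lambda$ on the diagonal, $1$ on the subdiagonal, and $0$ elsewhere (using the superdiagonal instead gives a similar matrix). -}

module Defs where

open import Algebra.Bundles using (CommutativeRing)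
open import Data.Bool.Base using (if_then_else_)
open import Data.Fin.Base using (Fin; toℕ; splitAt)
import Data.Fin.Properties as Fin
open import Data.Integer.Base as ℤ using (ℤ; +_; 0ℤ; 1ℤ)
open import Data.Integer.Divisibility.Signed using (_∣_; divides; ∣m∣n⇒∣m+n; ∣m⇒∣-m; ∣m⇒∣m*n; ∣n⇒∣m*n)
import Data.Integer.Properties as ℤ
open import Data.Integer.Tactic.RingSolver using (solve-∀)
open import Data.List.Base as List using (List; []; _∷_)
open import Data.Nat.Base as ℕ using (ℕ; suc; _∸_; NonZero)
open import Data.Nat.Combinatorics using (_C_)
open import Data.Nat.DivMod using (_/_)
import Data.Nat.Properties as ℕ
open import Data.Product.Base using (Σ-syntax; _,_)
open import Data.Sum.Base using (_⊎_; inj₁; inj₂)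
open import Level using (Level; 0ℓ; _⊔_)
open import Relation.Binary.PropositionalEquality using (_≡_; refl; subst)
open import Relation.Nullary.Decidable using (does)

⌈_/_⌉ : (n d : ℕ) .{{_ : NonZero d}} → ℕ
⌈ n / d ⌉ = (n ℕ.+ (d ∸ 1)) / d

infix 4 _≡_[mod_]

-- Congruence is a record, rather than a function unfolding to divisibility,
-- so that a and b can be inferred from a proof of it.
record _≡_[mod_] (a b : ℤ) (p : ℕ) : Set where
  constructor mod-eq
  field
    divisible : + p ∣ a ℤ.- b

open _≡_[mod_] public

module _ {p : ℕ} where

  mod-reflexive : ∀ {a b} → a ≡ b → a ≡ b [mod p ]
  mod-reflexive {a} refl = mod-eq (divides 0ℤ (ℤ.+-inverseʳ a))

  mod-sym : ∀ {a b} → a ≡ b [mod p ] → b ≡ a [mod p ]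
  mod-sym {a} {b} (mod-eq d) = mod-eq (subst (+ p ∣_) (eq a b) (∣m⇒∣-m d))
    where
    eq : ∀ a b → ℤ.- (a ℤ.- b) ≡ b ℤ.- a
    eq = solve-∀

  mod-trans : ∀ {a b c} → a ≡ b [mod p ] → b ≡ c [mod p ] → a ≡ c [mod p ]
  mod-trans {a} {b} {c} (mod-eq d) (mod-eq e) =
    mod-eq (subst (+ p ∣_) (eq a b c) (∣m∣n⇒∣m+n d e))
    where
    eq : ∀ a b c → (a ℤ.- b) ℤ.+ (b ℤ.- c) ≡ a ℤ.- c
    eq = solve-∀

  mod-+-cong : ∀ {a b c d} → a ≡ b [mod p ] → c ≡ d [mod p ] →
               a ℤ.+ c ≡ b ℤ.+ d [mod p ]
  mod-+-cong {a} {b} {c} {d} (mod-eq e) (mod-eq f) =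
    mod-eq (subst (+ p ∣_) (eq a b c d) (∣m∣n⇒∣m+n e f))
    where
    eq : ∀ a b c d → (a ℤ.- b) ℤ.+ (c ℤ.- d) ≡ (a ℤ.+ c) ℤ.- (b ℤ.+ d)
    eq = solve-∀

  mod-*-cong : ∀ {a b c d} → a ≡ b [mod p ] → c ≡ d [mod p ] →
               a ℤ.* c ≡ b ℤ.* d [mod p ]
  mod-*-cong {a} {b} {c} {d} (mod-eq e) (mod-eq f) =
    mod-eq (subst (+ p ∣_) (eq a b c d)
      (∣m∣n⇒∣m+n (∣m⇒∣m*n c e) (∣n⇒∣m*n b f)))
    where
    eq : ∀ a b c d → (a ℤ.- b) ℤ.* c ℤ.+ b ℤ.* (c ℤ.- d) ≡ a ℤ.* c ℤ.- b ℤ.* d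
    eq = solve-∀

  mod-neg-cong : ∀ {a b} → a ≡ b [mod p ] → ℤ.- a ≡ ℤ.- b [mod p ]
  mod-neg-cong {a} {b} (mod-eq d) = mod-eq (subst (+ p ∣_) (eq a b) (∣m⇒∣-m d))
    where
    eq : ∀ a b → ℤ.- (a ℤ.- b) ≡ (ℤ.- a) ℤ.- (ℤ.- b)
    eq = solve-∀

-- The ring ℤ/pℤ as a setoid: its elements are represented by integers, and
-- its equality is congruence modulo p.  For prime p it is the field 𝔽ₚ.
ℤ/_ : ℕ → CommutativeRing 0ℓ 0ℓ
ℤ/ p = record
  { Carrier = ℤ
  ; _≈_     = λ a b → a ≡ b [mod p ]
  ; _+_     = ℤ._+_
  ; _*_     = ℤ._*_
  ; -_      = ℤ.-_
  ; 0#      = 0ℤ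
  ; 1#      = 1ℤ
  ; isCommutativeRing = record
    { isRing = record
      { +-isAbelianGroup = record
        { isGroup = record
          { isMonoid = record
            { isSemigroup = record
              { isMagma = record
                { isEquivalence = record
                  { refl  = mod-reflexive refl
                  ; sym   = mod-sym
                  ; trans = mod-trans
                  }
                ; ∙-cong = mod-+-cong
                }
              ; assoc = λ a b c → mod-reflexive (ℤ.+-assoc a b c)
              }
            ; identity = (λ a → mod-reflexive (ℤ.+-identityˡ a))
                       , (λ a → mod-reflexive (ℤ.+-identityʳ a))
            }
          ; inverse = (λ a → mod-reflexive (ℤ.+-inverseˡ a))
                    , (λ a → mod-reflexive (ℤ.+-inverseʳ a))
          ; ⁻¹-cong = mod-neg-cong
          }
        ; comm = λ a b → mod-reflexive (ℤ.+-comm a b)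
        }
      ; *-cong     = mod-*-cong
      ; *-assoc    = λ a b c → mod-reflexive (ℤ.*-assoc a b c)
      ; *-identity = (λ a → mod-reflexive (ℤ.*-identityˡ a))
                   , (λ a → mod-reflexive (ℤ.*-identityʳ a))
      ; distrib    = (λ a b c → mod-reflexive (ℤ.*-distribˡ-+ a b c))
                   , (λ a b c → mod-reflexive (ℤ.*-distribʳ-+ a b c))
      }
    ; *-comm = λ a b → mod-reflexive (ℤ.*-comm a b)
    }
  }

-- Indices run from 0 instead of 1.  The entries are integers, hence also
-- representatives of elements of ℤ/ p for every p.
pascal : (n : ℕ) → Fin n → Fin n → ℤ
pascal n i j = + (toℕ i C toℕ j)

module JordanForm {c ℓ : Level} (R : CommutativeRing c ℓ) where

  open CommutativeRing R
  open import Algebra.Properties.Monoid.Sum +-monoid using (sum)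

  Matrix : ℕ → Set c
  Matrix n = Fin n → Fin n → Carrier

  infix 4 _≈ₘ_
  _≈ₘ_ : ∀ {n} → Matrix n → Matrix n → Set ℓ
  A ≈ₘ B = ∀ i j → A i j ≈ B i j

  infixl 7 _*ₘ_
  _*ₘ_ : ∀ {n} → Matrix n → Matrix n → Matrix n
  (A *ₘ B) i j = sum (λ k → A i k * B k j)

  1ₘ : ∀ {n} → Matrix n
  1ₘ i j = if does (i Fin.≟ j) then 1# else 0#

  record Similar {n : ℕ} (A B : Matrix n) : Set (c ⊔ ℓ) where
    field
      S S⁻¹    : Matrix n
      inverseʳ : S *ₘ S⁻¹ ≈ₘ 1ₘ
      inverseˡ : S⁻¹ *ₘ S ≈ₘ 1ₘ
      similar  : A ≈ₘ S *ₘ B *ₘ S⁻¹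

  infixr 6 _⊕_
  _⊕_ : ∀ {m n} → Matrix m → Matrix n → Matrix (m ℕ.+ n)
  _⊕_ {m} {n} A B i j = entry (splitAt m i) (splitAt m j)
    where
    entry : Fin m ⊎ Fin n → Fin m ⊎ Fin n → Carrier
    entry (inj₁ i) (inj₁ j) = A i j
    entry (inj₁ i) (inj₂ j) = 0#
    entry (inj₂ i) (inj₁ j) = 0#
    entry (inj₂ i) (inj₂ j) = B i j

  record Block : Set c where
    constructor block
    field
      size             : ℕ
      {{size-nonZero}} : NonZero size
      eigenvalue       : Carrier

  open Block public

  jordanBlock : (m : ℕ) → Carrier → Matrix m
  jordanBlock m μ i j =
    if does (i Fin.≟ j) then μ
    else if does (toℕ i ℕ.≟ suc (toℕ j)) then 1#
    else 0#

  dim : List Block → ℕ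
  dim []       = 0
  dim (b ∷ bs) = size b ℕ.+ dim bs

  jordanMatrix : (bs : List Block) → Matrix (dim bs)
  jordanMatrix []       = λ ()
  jordanMatrix (b ∷ bs) = jordanBlock (size b) (eigenvalue b) ⊕ jordanMatrix bs

  IsJordanForm : ∀ {n} → Matrix n → List Block → Set (c ⊔ ℓ)
  IsJordanForm {n} A bs =
    Σ[ eq ∈ dim bs ≡ n ] Similar A (subst Matrix eq (jordanMatrix bs))

  countOfSize : ℕ → List Block → ℕ
  countOfSize m bs = List.length (List.filter (λ b → size b ℕ.≟ m) bs)

{-# OPTIONS --safe #-}
module Submission where

-- Row i of the Pascal matrix expands (x + 1) ^ i, so the matrix describes the
-- substitution of x + 1 for x.  The falling factorials satisfy
-- (x + 1)ᵢ = (x)ᵢ + i (x)ᵢ₋₁; modulo p the coefficient i vanishes exactly when p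
-- divides i, and otherwise rescaling turns it into 1.  So in the basis of rescaled
-- falling factorials the matrix is in Jordan form, and every p-th index starts a
-- new block.  The change of basis and its inverse consist of (rescaled) Stirling
-- numbers of the first and second kind.
--
-- For uniqueness, an eigenvector of any Jordan form is transported to this one,
-- where 1 is the only eigenvalue.  If N is the nilpotent part, then ker N ∩ im N ^ j
-- is invariant under similarity and its dimension is the number of blocks of size
-- greater than j.  The values j = 0, p - 1, p determine the number of blocks and
-- the number of those of size p.

open import Defs
open import Algebra.Bundles using (CommutativeRing)
open import Data.Empty using (⊥-elim)
open import Data.Fin.Base using (Fin; zero; suc; toℕ; fromℕ<; inject₁; punchIn; punchOut; splitAt; join; _↑ˡ_; _↑ʳ_)
import Data.Fin.Properties as Fin
open import Data.Integer.Base as ℤ using (ℤ; +_; -[1+_]; 1ℤ)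
open import Data.Integer.Divisibility.Signed using (divides; ∣⇒∣ᵤ; ∣ᵤ⇒∣)
import Data.Integer.Properties as ℤ
open import Data.Integer.Tactic.RingSolver using (solve-∀)
open import Data.List.Base using (List; []; _∷_; length)
open import Data.List.Membership.Propositional using (_∈_)
import Data.List.Properties as List
open import Data.List.Relation.Unary.All as All using (All; []; _∷_)
open import Data.List.Relation.Unary.Any using (here; there)
open import Data.Nat.Base as ℕ using (ℕ; zero; suc; _≤_; _<_; _≥_; z≤n; s≤s; _∸_; NonZero)
open import Data.Nat.Combinatorics using (_C_; nCk+nC[k+1]≡[n+1]C[k+1]; k>n⇒nCk≡0)
open import Data.Nat.Coprimality using (Coprime; coprime-Bézout)
open import Data.Nat.Divisibility using (_∣_; _∣?_; _∣0; ∣1⇒≡1; ∣-refl; ∣m∣n⇒∣m+n; ∣m+n∣m⇒∣n; ∣⇒≤)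
open import Data.Nat.DivMod using (_/_; _%_; m≡m%n+[m/n]*n; m%n<n; m%n≤n; n/n≡1; m<n⇒m/n≡0; +-distrib-/-∣ˡ; +-distrib-/-∣ʳ)
open import Data.Nat.GCD using (module Bézout)
open import Data.Nat.GeneralisedArithmetic using (fold)
open import Data.Nat.Primality using (Prime; ¬prime[1]; prime⇒irreducible)
import Data.Nat.Properties as ℕ
open import Data.Product.Base using (∃; _×_; _,_; proj₁; proj₂)
open import Data.Sum.Base using (_⊎_; inj₁; inj₂)
open import Data.Vec.Functional using (Vector; _++_; removeAt; replicate) renaming (_∷_ to infixr 5 _◂_)
import Data.Vec.Functional.Properties as Vec
open import Function.Base using (_∘_; id)
open import Level using (_⊔_)
open import Relation.Binary.PropositionalEquality as ≡ using (_≡_)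
open import Relation.Nullary.Decidable using (yes; no)
open import Relation.Nullary.Negation using (¬_; contradiction)

-- Case distinctions over finite index types.

↑-cases : ∀ {a m n} {P : Fin (m ℕ.+ n) → Set a} →
          (∀ i → P (i ↑ˡ n)) → (∀ j → P (m ↑ʳ j)) → ∀ i → P i
↑-cases {m = m} {n} {P} l r i = ≡.subst P (Fin.join-splitAt m n i) (go (splitAt m i))
  where
  go : ∀ s → P (join m n s)
  go (inj₁ i) = l i
  go (inj₂ j) = r j

-- A finite search, used to find a pivot: if every entry of a column is zero or a unit, then the
-- column vanishes or contains a unit.
∀⊎∃ : ∀ {a b n} {P : Fin n → Set a} {Q : Fin n → Set b} →
      (∀ i → P i ⊎ Q i) → (∀ i → P i) ⊎ ∃ Q
∀⊎∃ {n = zero}  d = inj₁ λ ()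
∀⊎∃ {n = suc n} d with d zero | ∀⊎∃ (d ∘ suc)
... | inj₂ q | _            = inj₂ (zero , q)
... | inj₁ p | inj₁ ps      = inj₁ λ { zero → p ; (suc i) → ps i }
... | inj₁ p | inj₂ (i , q) = inj₂ (suc i , q)

-- Linear maps between coordinate spaces over a commutative ring.

module LinearAlgebra {c ℓ} (R : CommutativeRing c ℓ) where

  open CommutativeRing R hiding (zero)
  open JordanForm R
  open import Algebra.Properties.Ring ring using (-‿distribˡ-*)
  open import Algebra.Properties.Group +-group using (∙-cancelˡ; x∙y⁻¹≈ε⇒x≈y)
  open import Algebra.Properties.CommutativeSemigroup *-commutativeSemigroup using (x∙yz≈y∙xz)
  open import Algebra.Properties.Semiring.Sum semiring
  open import Data.Vec.Functional.Relation.Binary.Equality.Setoid setoid using (_≋_; ≋-refl; ≋-sym; ≋-trans)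
  open import Relation.Binary.Reasoning.Setoid setoid

  -- The field axioms in the constructive form that elimination needs: each element can be decided
  -- to be zero or given an inverse.
  record IsField : Set (c ⊔ ℓ) where
    field
      1≉0        : ¬ 1# ≈ 0#
      zeroOrUnit : ∀ x → x ≈ 0# ⊎ ∃ λ y → x * y ≈ 1#

  V : ℕ → Set c
  V = Vector Carrier

  0ᵥ : ∀ {n} → V n
  0ᵥ = replicate _ 0#

  infixl 6 _+ᵥ_
  _+ᵥ_ : ∀ {n} → V n → V n → V n
  (x +ᵥ y) i = x i + y i

  infixl 7 _*ᵥ_
  _*ᵥ_ : ∀ {n} → Carrier → V n → V n
  (a *ᵥ x) i = a * x i

  record Linear {m n} (f : V m → V n) : Set (c ⊔ ℓ) where
    field
      cong   : ∀ {x y} → x ≋ y → f x ≋ f y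
      +-homo : ∀ x y → f (x +ᵥ y) ≋ f x +ᵥ f y
      *-homo : ∀ a x → f (a *ᵥ x) ≋ a *ᵥ f x

    0-homo : f 0ᵥ ≋ 0ᵥ
    0-homo i = begin
      f 0ᵥ i         ≈⟨ cong {0ᵥ} {0# *ᵥ 0ᵥ} (λ _ → sym (zeroˡ 0#)) i ⟩
      f (0# *ᵥ 0ᵥ) i ≈⟨ *-homo 0# 0ᵥ i ⟩
      0# * f 0ᵥ i    ≈⟨ zeroˡ _ ⟩
      0#             ∎

  open Linear

  id-linear : ∀ {n} → Linear (id {A = V n})
  id-linear .cong   e     = e
  id-linear .+-homo x y i = refl
  id-linear .*-homo a x i = refl

  infixr 9 _∘ₗ_
  _∘ₗ_ : ∀ {l m n} {g : V m → V n} {f : V l → V m} →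
         Linear g → Linear f → Linear (g ∘ f)
  (lg ∘ₗ lf) .cong   e   = lg .cong (lf .cong e)
  (lg ∘ₗ lf) .+-homo x y = ≋-trans (lg .cong (lf .+-homo x y)) (lg .+-homo _ _)
  (lg ∘ₗ lf) .*-homo a x = ≋-trans (lg .cong (lf .*-homo a x)) (lg .*-homo _ _)

  reindex-linear : ∀ {m n} (r : Fin n → Fin m) → Linear {m} {n} (_∘ r)
  reindex-linear r .cong   e i   = e (r i)
  reindex-linear r .+-homo x y i = refl
  reindex-linear r .*-homo a x i = refl

  e₀ : ∀ {n} → V (suc n)
  e₀ = 1# ◂ 0ᵥ

  -- Gaussian elimination on the first column: if f e₀ has a unit in position
  -- r, prepend to v the entry that makes position r of the image vanish.
  injective⇒≤ : IsField → ∀ {m n} {f : V m → V n} → Linear f →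
                (∀ v → f v ≋ 0ᵥ → v ≋ 0ᵥ) → m ≤ n
  injective⇒≤ F {zero} lin inj = z≤n
  injective⇒≤ F {suc m} {n} {f} lin inj with ∀⊎∃ (IsField.zeroOrUnit F ∘ f e₀)
  -- A vanishing first column contradicts injectivity. This branch also covers `n = 0`, where there
  -- is no position for a pivot.
  ... | inj₁ fe₀≋0 = ⊥-elim (IsField.1≉0 F (inj e₀ fe₀≋0 zero))
  injective⇒≤ F {suc m} {suc n} {f} lin inj | inj₂ (r , y , unit) =
    s≤s (injective⇒≤ F f′-linear f′-injective)
    where
    h : V m → Carrier
    h v = f (0# ◂ v) r * - y

    ext : V m → V (suc m)
    ext v = h v ◂ v

    0◂-linear : Linear {m} (0# ◂_)
    0◂-linear .cong   e zero      = refl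
    0◂-linear .cong   e (suc i)   = e i
    0◂-linear .+-homo x y zero    = sym (+-identityˡ 0#)
    0◂-linear .+-homo x y (suc i) = refl
    0◂-linear .*-homo a x zero    = sym (zeroʳ a)
    0◂-linear .*-homo a x (suc i) = refl

    f0-linear : Linear (f ∘ (0# ◂_))
    f0-linear = lin ∘ₗ 0◂-linear

    ext-linear : Linear ext
    ext-linear .cong   e zero      = *-congʳ (f0-linear .cong e r)
    ext-linear .cong   e (suc i)   = e i
    ext-linear .+-homo x y zero    = trans (*-congʳ (f0-linear .+-homo x y r)) (distribʳ _ _ _)
    ext-linear .+-homo x y (suc i) = refl
    ext-linear .*-homo a x zero    = trans (*-congʳ (f0-linear .*-homo a x r)) (*-assoc _ _ _)
    ext-linear .*-homo a x (suc i) = refl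

    f′ : V m → V n
    f′ v = removeAt (f (ext v)) r

    f′-linear : Linear f′
    f′-linear = reindex-linear (punchIn r) ∘ₗ lin ∘ₗ ext-linear

    pivot : ∀ v → f (ext v) r ≈ 0#
    pivot v = begin
      f (ext v) r                          ≈⟨ lin .cong split r ⟩
      f (h v *ᵥ e₀ +ᵥ (0# ◂ v)) r          ≈⟨ lin .+-homo _ _ r ⟩
      f (h v *ᵥ e₀) r + f (0# ◂ v) r       ≈⟨ +-congʳ (lin .*-homo _ _ r) ⟩
      h v * f e₀ r + f (0# ◂ v) r          ≈⟨ +-cong (*-assoc _ _ _) (sym (*-identityʳ _)) ⟩
      f (0# ◂ v) r * (- y * f e₀ r) + f (0# ◂ v) r * 1# ≈⟨ distribˡ _ _ _ ⟨
      f (0# ◂ v) r * (- y * f e₀ r + 1#)   ≈⟨ *-congˡ (+-congʳ -y*c≈-1) ⟩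
      f (0# ◂ v) r * (- 1# + 1#)           ≈⟨ *-congˡ (-‿inverseˡ 1#) ⟩
      f (0# ◂ v) r * 0#                    ≈⟨ zeroʳ _ ⟩
      0#                                   ∎
      where
      split : ext v ≋ h v *ᵥ e₀ +ᵥ (0# ◂ v)
      split zero    = sym (trans (+-identityʳ _) (*-identityʳ _))
      split (suc i) = sym (trans (+-congʳ (zeroʳ _)) (+-identityˡ _))
      -y*c≈-1 : - y * f e₀ r ≈ - 1#
      -y*c≈-1 = trans (sym (-‿distribˡ-* _ _)) (-‿cong (trans (*-comm _ _) unit))

    f′-injective : ∀ v → f′ v ≋ 0ᵥ → v ≋ 0ᵥ
    f′-injective v f′v≋0 = inj (ext v) f≋0 ∘ suc
      where
      f≋0 : f (ext v) ≋ 0ᵥ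
      f≋0 i with r Fin.≟ i
      ... | yes ≡.refl = pivot v
      ... | no r≢i     = ≡.subst (λ j → f (ext v) j ≈ 0#)
                           (Fin.punchIn-punchOut r≢i) (f′v≋0 (punchOut r≢i))

  -- Matrices as linear maps, and conjugacy.

  infixr 8 _·_
  _·_ : ∀ {n} → Matrix n → V n → V n
  (A · v) i = ∑[ k < _ ] (A i k * v k)

  ·-linear : ∀ {n} (A : Matrix n) → Linear (A ·_)
  ·-linear A .cong   e i   = sum-cong-≋ (λ k → *-congˡ (e k))
  ·-linear A .+-homo x y i = trans (sum-cong-≋ (λ k → distribˡ (A i k) (x k) (y k)))
                                   (∑-distrib-+ (λ k → A i k * x k) _)
  ·-linear {n} A .*-homo a x i = trans (sum-cong-≋ (λ k → x∙yz≈y∙xz (A i k) a (x k)))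
                                   (sym (*-distribˡ-sum {n} a _))

  ·-congʳ : ∀ {n} {A B : Matrix n} → A ≈ₘ B → ∀ v → A · v ≋ B · v
  ·-congʳ e v i = sum-cong-≋ (λ k → *-congʳ (e i k))

  *ₘ-· : ∀ {n} (A B : Matrix n) v → (A *ₘ B) · v ≋ A · B · v
  *ₘ-· {n} A B v i = begin
    ∑[ k < _ ] (∑[ l < _ ] (A i l * B l k) * v k)   ≈⟨ sum-cong-≋ (λ k → *-distribʳ-sum {n} (v k) _) ⟩
    ∑[ k < _ ] ∑[ l < _ ] (A i l * B l k * v k)   ≈⟨ ∑-comm {n} {n} _ ⟩
    ∑[ l < _ ] ∑[ k < _ ] (A i l * B l k * v k)   ≈⟨ sum-cong-≋ (λ l → sum-cong-≋ (λ k → *-assoc (A i l) (B l k) (v k))) ⟩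
    ∑[ l < _ ] ∑[ k < _ ] (A i l * (B l k * v k))   ≈⟨ sum-cong-≋ (λ l → *-distribˡ-sum {n} (A i l) _) ⟨
    ∑[ l < _ ] (A i l * ∑[ k < _ ] (B l k * v k))   ∎

  sum-0* : ∀ {n} (v : V n) → ∑[ k < n ] (0# * v k) ≈ 0#
  sum-0* {n} v = trans (sum-cong-≋ (λ k → zeroˡ (v k))) (sum-replicate-zero n)

  1ₘ-· : ∀ {n} (v : V n) → 1ₘ · v ≋ v
  1ₘ-· v zero    = trans (+-cong (*-identityˡ _) (sum-0* (v ∘ suc))) (+-identityʳ _)
  1ₘ-· v (suc i) = trans (+-cong (zeroˡ _) (1ₘ-· (v ∘ suc) i)) (+-identityˡ _)

  -- Conjugacy by a linear isomorphism. The two sizes may differ as expressions, so Jordan matrices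
  -- can be compared without transport along an equation between dimensions.
  record _∼_ {m n} (A : Matrix m) (B : Matrix n) : Set (c ⊔ ℓ) where
    field
      to          : V m → V n
      from        : V n → V m
      to-linear   : Linear to
      from-linear : Linear from
      to∘from     : ∀ w → to (from w) ≋ w
      from∘to     : ∀ v → from (to v) ≋ v
      commute     : ∀ v → to (A · v) ≋ B · to v

    to-injective : ∀ v → to v ≋ 0ᵥ → v ≋ 0ᵥ
    to-injective v e =
      ≋-trans (≋-sym (from∘to v)) (≋-trans (from-linear .cong e) (0-homo from-linear))

  ∼-sym : ∀ {m n} {A : Matrix m} {B : Matrix n} → A ∼ B → B ∼ A
  ∼-sym {A = A} {B} A∼B = record
    { to = from ; from = to ; to-linear = from-linear ; from-linear = to-linear
    ; to∘from = from∘to ; from∘to = to∘from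
    ; commute = λ w i → begin
        from (B · w) i             ≈⟨ from-linear .cong (·-linear B .cong (to∘from w)) i ⟨
        from (B · to (from w)) i   ≈⟨ from-linear .cong (commute (from w)) i ⟨
        from (to (A · from w)) i   ≈⟨ from∘to (A · from w) i ⟩
        (A · from w) i             ∎
    }
    where open _∼_ A∼B

  ∼-trans : ∀ {l m n} {A : Matrix l} {B : Matrix m} {C : Matrix n} →
            A ∼ B → B ∼ C → A ∼ C
  ∼-trans A∼B B∼C = record
    { to = B∼C.to ∘ A∼B.to ; from = A∼B.from ∘ B∼C.from
    ; to-linear = B∼C.to-linear ∘ₗ A∼B.to-linear
    ; from-linear = A∼B.from-linear ∘ₗ B∼C.from-linear
    ; to∘from = λ w → ≋-trans (B∼C.to-linear .cong (A∼B.to∘from _)) (B∼C.to∘from w)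
    ; from∘to = λ v → ≋-trans (A∼B.from-linear .cong (B∼C.from∘to _)) (A∼B.from∘to v)
    ; commute = λ v → ≋-trans (B∼C.to-linear .cong (A∼B.commute v)) (B∼C.commute _)
    }
    where
    module A∼B = _∼_ A∼B
    module B∼C = _∼_ B∼C

  -- From A = S B S⁻¹ follows A S = S B, so `S` carries the action of B to that of A; this is why
  -- the order is reversed.
  similar⇒∼ : ∀ {n} {A B : Matrix n} → Similar A B → B ∼ A
  similar⇒∼ {A = A} {B} sim = record
    { to = S ·_ ; from = S⁻¹ ·_ ; to-linear = ·-linear S ; from-linear = ·-linear S⁻¹
    ; to∘from = cancel {S} {S⁻¹} inverseʳ
    ; from∘to = cancel {S⁻¹} {S} inverseˡ
    ; commute = λ v i → begin
        (S · B · v) i                   ≈⟨ ·-linear S .cong (·-linear B .cong (cancel inverseˡ v)) i ⟨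
        (S · B · S⁻¹ · S · v) i         ≈⟨ *ₘ-· S B (S⁻¹ · S · v) i ⟨
        ((S *ₘ B) · S⁻¹ · S · v) i      ≈⟨ *ₘ-· (S *ₘ B) S⁻¹ (S · v) i ⟨
        ((S *ₘ B *ₘ S⁻¹) · S · v) i     ≈⟨ ·-congʳ similar (S · v) i ⟨
        (A · S · v) i                   ∎
    }
    where
    open Similar sim
    cancel : ∀ {X Y} → X *ₘ Y ≈ₘ 1ₘ → ∀ v → X · Y · v ≋ v
    cancel {X} {Y} e v = ≋-trans (≋-sym (*ₘ-· X Y v)) (≋-trans (·-congʳ e v) (1ₘ-· v))

  isJordanForm⇒∼ : ∀ {n} {A : Matrix n} bs → IsJordanForm A bs → jordanMatrix bs ∼ A
  isJordanForm⇒∼ bs (≡.refl , sim) = similar⇒∼ sim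

  -- Jordan matrices split into a diagonal and a nilpotent part.

  sum-++ : ∀ m {n} (t : V (m ℕ.+ n)) →
           sum t ≈ sum (t ∘ (_↑ˡ n)) + sum (t ∘ (m ↑ʳ_))
  sum-++ zero    t = sym (+-identityˡ _)
  sum-++ (suc m) t = trans (+-congˡ (sum-++ m (t ∘ suc))) (sym (+-assoc _ _ _))

  module _ {m n} (A : Matrix m) (B : Matrix n) where

    ⊕-↑ˡ↑ˡ : ∀ i j → (A ⊕ B) (i ↑ˡ n) (j ↑ˡ n) ≡ A i j
    ⊕-↑ˡ↑ˡ i j rewrite Fin.splitAt-↑ˡ m i n | Fin.splitAt-↑ˡ m j n = ≡.refl

    ⊕-↑ˡ↑ʳ : ∀ i j → (A ⊕ B) (i ↑ˡ n) (m ↑ʳ j) ≡ 0#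
    ⊕-↑ˡ↑ʳ i j rewrite Fin.splitAt-↑ˡ m i n | Fin.splitAt-↑ʳ m n j = ≡.refl

    ⊕-↑ʳ↑ˡ : ∀ i j → (A ⊕ B) (m ↑ʳ i) (j ↑ˡ n) ≡ 0#
    ⊕-↑ʳ↑ˡ i j rewrite Fin.splitAt-↑ʳ m n i | Fin.splitAt-↑ˡ m j n = ≡.refl

    ⊕-↑ʳ↑ʳ : ∀ i j → (A ⊕ B) (m ↑ʳ i) (m ↑ʳ j) ≡ B i j
    ⊕-↑ʳ↑ʳ i j rewrite Fin.splitAt-↑ʳ m n i | Fin.splitAt-↑ʳ m n j = ≡.refl

    ⊕-·-↑ˡ : ∀ v i → ((A ⊕ B) · v) (i ↑ˡ n) ≈ (A · v ∘ (_↑ˡ n)) i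
    ⊕-·-↑ˡ v i = begin
      ((A ⊕ B) · v) (i ↑ˡ n)                                  ≈⟨ sum-++ m _ ⟩
      _ + _                                                   ≈⟨ +-cong
        (sum-cong-≋ {m} (λ j → *-congʳ (reflexive (⊕-↑ˡ↑ˡ i j))))
        (sum-cong-≋ {n} (λ j → *-congʳ (reflexive (⊕-↑ˡ↑ʳ i j)))) ⟩
      (A · v ∘ (_↑ˡ n)) i + ∑[ j < n ] (0# * v (m ↑ʳ j))      ≈⟨ +-congˡ (sum-0* (v ∘ (m ↑ʳ_))) ⟩
      (A · v ∘ (_↑ˡ n)) i + 0#                                ≈⟨ +-identityʳ _ ⟩
      (A · v ∘ (_↑ˡ n)) i                                     ∎

    ⊕-·-↑ʳ : ∀ v i → ((A ⊕ B) · v) (m ↑ʳ i) ≈ (B · v ∘ (m ↑ʳ_)) i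
    ⊕-·-↑ʳ v i = begin
      ((A ⊕ B) · v) (m ↑ʳ i)                                  ≈⟨ sum-++ m _ ⟩
      _ + _                                                   ≈⟨ +-cong
        (sum-cong-≋ {m} (λ j → *-congʳ (reflexive (⊕-↑ʳ↑ˡ i j))))
        (sum-cong-≋ {n} (λ j → *-congʳ (reflexive (⊕-↑ʳ↑ʳ i j)))) ⟩
      ∑[ j < m ] (0# * v (j ↑ˡ n)) + (B · v ∘ (m ↑ʳ_)) i      ≈⟨ +-congʳ (sum-0* (v ∘ (_↑ˡ n))) ⟩
      0# + (B · v ∘ (m ↑ʳ_)) i                                ≈⟨ +-identityˡ _ ⟩
      (B · v ∘ (m ↑ʳ_)) i                                     ∎

  -- The nilpotent part of one Jordan block: ones on the subdiagonal send each basis vector to the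
  -- next and the last one to zero.
  shift : ∀ {n} → V n → V n
  shift v zero    = 0#
  shift v (suc i) = v (inject₁ i)

  shift-linear : ∀ {n} → Linear (shift {n})
  shift-linear .cong   e zero      = refl
  shift-linear .cong   e (suc i)   = e (inject₁ i)
  shift-linear .+-homo x y zero    = sym (+-identityˡ 0#)
  shift-linear .+-homo x y (suc i) = refl
  shift-linear .*-homo a x zero    = sym (zeroʳ a)
  shift-linear .*-homo a x (suc i) = refl

  shift-lookup : ∀ {n} (v : V n) {i j : Fin n} → toℕ j ≡ suc (toℕ i) → shift v j ≡ v i
  shift-lookup v {i} {suc j} e =
    ≡.cong v (Fin.toℕ-injective (≡.trans (Fin.toℕ-inject₁ j) (ℕ.suc-injective e)))

  -- Deleting row 0 and column 0 leaves a smaller Jordan block. The deleted column is non-zero at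
  -- most in rows 0 and 1, hence the three cases.
  jordanBlock-· : ∀ m μ (v : V m) → jordanBlock m μ · v ≋ μ *ᵥ v +ᵥ shift v
  jordanBlock-· (suc m) μ v zero          = +-congˡ (sum-0* (v ∘ suc))
  jordanBlock-· (suc (suc m)) μ v (suc zero)    = begin
    1# * v zero + (jordanBlock (suc m) μ · v ∘ suc) zero  ≈⟨ +-cong (*-identityˡ _) (jordanBlock-· (suc m) μ (v ∘ suc) zero) ⟩
    v zero + (μ * v (suc zero) + 0#)                      ≈⟨ +-congˡ (+-identityʳ _) ⟩
    v zero + μ * v (suc zero)                             ≈⟨ +-comm _ _ ⟩
    μ * v (suc zero) + v zero                             ∎
  jordanBlock-· (suc m) μ v (suc (suc i)) =
    trans (+-congʳ (zeroˡ _))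
      (trans (+-identityˡ _) (jordanBlock-· m μ (v ∘ suc) (suc i)))

  eigenvalues : ∀ bs → V (dim bs)
  eigenvalues []       = λ ()
  eigenvalues (b ∷ bs) = replicate (size b) (eigenvalue b) ++ eigenvalues bs

  -- Each block is shifted separately; nothing is carried over from one block into the next.
  nilpotent : ∀ bs → V (dim bs) → V (dim bs)
  nilpotent []       v = λ ()
  nilpotent (b ∷ bs) v = shift (v ∘ (_↑ˡ dim bs)) ++ nilpotent bs (v ∘ (size b ↑ʳ_))

  module _ (b : Block) (bs : List Block) where

    eigenvalues-↑ˡ : ∀ i → eigenvalues (b ∷ bs) (i ↑ˡ dim bs) ≡ eigenvalue b
    eigenvalues-↑ˡ = Vec.lookup-++ˡ _ (eigenvalues bs)

    eigenvalues-↑ʳ : ∀ i → eigenvalues (b ∷ bs) (size b ↑ʳ i) ≡ eigenvalues bs i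
    eigenvalues-↑ʳ = Vec.lookup-++ʳ (replicate (size b) (eigenvalue b)) _

    nilpotent-↑ˡ : ∀ v i → nilpotent (b ∷ bs) v (i ↑ˡ dim bs) ≡ shift (v ∘ (_↑ˡ dim bs)) i
    nilpotent-↑ˡ v = Vec.lookup-++ˡ _ (nilpotent bs _)

    nilpotent-↑ʳ : ∀ v i → nilpotent (b ∷ bs) v (size b ↑ʳ i) ≡ nilpotent bs (v ∘ (size b ↑ʳ_)) i
    nilpotent-↑ʳ v = Vec.lookup-++ʳ (shift (v ∘ (_↑ˡ dim bs))) _

  jordanMatrix-· : ∀ bs v → jordanMatrix bs · v ≋
                   (λ i → eigenvalues bs i * v i + nilpotent bs v i)
  jordanMatrix-· []       v ()
  jordanMatrix-· (b ∷ bs) v = ↑-cases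
    (λ i → trans (⊕-·-↑ˡ _ (jordanMatrix bs) v i) (trans (jordanBlock-· (size b) (eigenvalue b) _ i)
      (+-cong (*-congʳ (reflexive (≡.sym (eigenvalues-↑ˡ b bs i))))
              (reflexive (≡.sym (nilpotent-↑ˡ b bs v i))))))
    (λ i → trans (⊕-·-↑ʳ (jordanBlock (size b) (eigenvalue b)) _ v i) (trans (jordanMatrix-· bs _ i)
      (+-cong (*-congʳ (reflexive (≡.sym (eigenvalues-↑ʳ b bs i))))
              (reflexive (≡.sym (nilpotent-↑ʳ b bs v i))))))

  ++-linear : ∀ {l m n} {f : V l → V m} {g : V l → V n} →
              Linear f → Linear g → Linear (λ v → f v ++ g v)
  ++-linear {m = m} lf lg .cong e i with splitAt m i
  ... | inj₁ j = lf .cong e j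
  ... | inj₂ j = lg .cong e j
  ++-linear {m = m} lf lg .+-homo x y i with splitAt m i
  ... | inj₁ j = lf .+-homo x y j
  ... | inj₂ j = lg .+-homo x y j
  ++-linear {m = m} lf lg .*-homo a x i with splitAt m i
  ... | inj₁ j = lf .*-homo a x j
  ... | inj₂ j = lg .*-homo a x j

  []-linear : ∀ {n} {f : V n → V 0} → Linear f
  []-linear .cong   _   ()
  []-linear .+-homo _ _ ()
  []-linear .*-homo _ _ ()

  0ᵥ-linear : ∀ {m n} → Linear {m} {n} (λ _ → 0ᵥ)
  0ᵥ-linear .cong   _ _   = refl
  0ᵥ-linear .+-homo _ _ _ = sym (+-identityˡ 0#)
  0ᵥ-linear .*-homo a _ _ = sym (zeroʳ a)

  nilpotent-linear : ∀ bs → Linear (nilpotent bs)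
  nilpotent-linear []       = []-linear
  nilpotent-linear (b ∷ bs) = ++-linear
    (shift-linear ∘ₗ reindex-linear (_↑ˡ dim bs))
    (nilpotent-linear bs ∘ₗ reindex-linear (size b ↑ʳ_))

  -- Powers of the nilpotent part and standard basis vectors; `fold v f j` is the j-th iterate of
  -- `f` at `v`.

  fold-linear : ∀ {n} {f : V n → V n} → Linear f → ∀ j → Linear (λ v → fold v f j)
  fold-linear lf zero    = id-linear
  fold-linear lf (suc j) = lf ∘ₗ fold-linear lf j

  fold-commute : ∀ {m n} {f : V m → V m} {g : V n → V n} {h : V m → V n} →
                 Linear g → (∀ v → h (f v) ≋ g (h v)) →
                 ∀ j v → h (fold v f j) ≋ fold (h v) g j
  fold-commute lg hf≋gh zero    v = ≋-refl
  fold-commute lg hf≋gh (suc j) v = ≋-trans (hf≋gh _) (lg .cong (fold-commute lg hf≋gh j v))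

  nilpotent^-↑ˡ : ∀ b bs j {u v} → u ∘ (_↑ˡ dim bs) ≋ v →
    fold u (nilpotent (b ∷ bs)) j ∘ (_↑ˡ dim bs) ≋ fold v shift j
  nilpotent^-↑ˡ b bs j {u} e = ≋-trans
    (fold-commute shift-linear (λ v i → reflexive (nilpotent-↑ˡ b bs v i)) j u)
    (fold-linear shift-linear j .cong e)

  nilpotent^-↑ʳ : ∀ b bs j {u v} → u ∘ (size b ↑ʳ_) ≋ v →
    fold u (nilpotent (b ∷ bs)) j ∘ (size b ↑ʳ_) ≋ fold v (nilpotent bs) j
  nilpotent^-↑ʳ b bs j {u} e = ≋-trans
    (fold-commute (nilpotent-linear bs) (λ v i → reflexive (nilpotent-↑ʳ b bs v i)) j u)
    (fold-linear (nilpotent-linear bs) j .cong e)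

  δ : ℕ → ℕ → Carrier
  δ zero    zero    = 1#
  δ zero    (suc j) = 0#
  δ (suc i) zero    = 0#
  δ (suc i) (suc j) = δ i j

  δ-refl : ∀ i → δ i i ≈ 1#
  δ-refl zero    = refl
  δ-refl (suc i) = δ-refl i

  δ-≢ : ∀ i j → ¬ i ≡ j → δ i j ≈ 0#
  δ-≢ zero    zero    i≢j = contradiction ≡.refl i≢j
  δ-≢ zero    (suc j) i≢j = refl
  δ-≢ (suc i) zero    i≢j = refl
  δ-≢ (suc i) (suc j) i≢j = δ-≢ i j (i≢j ∘ ≡.cong suc)

  -- The index is an unbounded natural number, so that shifting past the last coordinate yields the
  -- zero vector without side conditions.
  e[_] : ∀ {n} → ℕ → V n
  e[ k ] = δ k ∘ toℕ

  shift-e : ∀ {n} k → shift {n} e[ k ] ≋ e[ suc k ]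
  shift-e k zero    = refl
  shift-e k (suc i) = reflexive (≡.cong (δ k) (Fin.toℕ-inject₁ i))

  shift^-e : ∀ {n} j k a → fold {A = V n} (a *ᵥ e[ k ]) shift j ≋ a *ᵥ e[ j ℕ.+ k ]
  shift^-e zero    k a i = refl
  shift^-e {n} (suc j) k a = ≋-trans (shift-linear .cong (shift^-e j k a))
    (≋-trans (shift-linear {n} .*-homo a _) (λ i → *-congˡ (shift-e (j ℕ.+ k) i)))

  -- Kernels and images of powers of the nilpotent part, and the blocks that they count.

  e-overflow : ∀ n → e[ n ] ≋ 0ᵥ {n}
  e-overflow n i = δ-≢ n (toℕ i) (ℕ.>⇒≢ (Fin.toℕ<n i))

  -- Every shift brings in one more zero at the front. In particular the j-th power of the shift is
  -- zero on a block of size at most j.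
  shift^-low : ∀ {n} j (u : V n) i → toℕ i < j → fold u shift j i ≈ 0#
  shift^-low (suc j) u zero    i<j       = refl
  shift^-low (suc j) u (suc i) (s≤s i<j) =
    shift^-low j u (inject₁ i) (≡.subst (_< j) (≡.sym (Fin.toℕ-inject₁ i)) i<j)

  -- The shift forgets only the last coordinate; every other one reappears one place later.
  shift-kernel : ∀ {n} (w : V n) l → suc (toℕ l) ≡ n → shift w ≋ 0ᵥ → w l ≈ 0# → w ≋ 0ᵥ
  shift-kernel {n} w l l-last sw≋0 wl≈0 i with ℕ.m≤n⇒m<n∨m≡n (Fin.toℕ<n i)
  ... | inj₁ 1+i<n = trans (reflexive (≡.sym (shift-lookup w (Fin.toℕ-fromℕ< 1+i<n))))
                           (sw≋0 (fromℕ< 1+i<n))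
  ... | inj₂ i-last =
    ≡.subst (λ l → w l ≈ 0#)
      (Fin.toℕ-injective (ℕ.suc-injective (≡.trans l-last (≡.sym i-last)))) wl≈0

  -- `Tops j bs k` states that exactly k blocks have size greater than j. As an inductive family it
  -- also selects these blocks, and the maps below recurse on this selection.
  data Tops (j : ℕ) : List Block → ℕ → Set c where
    []   : Tops j [] 0
    long  : ∀ {b bs k} → j < size b → Tops j bs k → Tops j (b ∷ bs) (suc k)
    short : ∀ {b bs k} → size b ≤ j → Tops j bs k → Tops j (b ∷ bs) k

  -- The index of the basis vector that j shifts move to the last place m - 1.
  top : ∀ {j m} → j < m → ℕ
  top {j} {m} _ = m ∸ suc j

  j+top<m : ∀ {j m} (j<m : j < m) → suc (j ℕ.+ top j<m) ≡ m
  j+top<m j<m = ℕ.m+[n∸m]≡n j<m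

  last : ∀ {j m} → j < m → Fin m
  last j<m = fromℕ< (ℕ.≤-reflexive (j+top<m j<m))

  toℕ-last : ∀ {j m} (j<m : j < m) → toℕ (last j<m) ≡ j ℕ.+ top j<m
  toℕ-last j<m = Fin.toℕ-fromℕ< (ℕ.≤-reflexive (j+top<m j<m))

  -- For N = nilpotent bs, the power N ^ j maps the image of embed isomorphically
  -- onto ker N ∩ im N ^ j, whose elements are determined by the coordinates that
  -- read selects.
  embed : ∀ {j bs k} → Tops j bs k → V k → V (dim bs)
  embed []                  c = λ ()
  embed (long j<m t)        c = (c zero *ᵥ e[ top j<m ]) ++ embed t (c ∘ suc)
  embed (short {b} m≤j t)   c = 0ᵥ {size b} ++ embed t c

  read : ∀ {j bs k} → Tops j bs k → V (dim bs) → V k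
  read []                       w = λ ()
  read (long {b} {bs} j<m t)    w = w (last j<m ↑ˡ dim bs) ◂ read t (w ∘ (size b ↑ʳ_))
  read (short {b} m≤j t)        w = read t (w ∘ (size b ↑ʳ_))

  embed-linear : ∀ {j bs k} (t : Tops j bs k) → Linear (embed t)
  embed-linear []                = []-linear
  embed-linear (long j<m t)      = ++-linear
    (record { cong   = λ e i → *-congʳ (e zero)
            ; +-homo = λ x y i → distribʳ _ _ _
            ; *-homo = λ a x i → *-assoc _ _ _ })
    (embed-linear t ∘ₗ reindex-linear suc)
  embed-linear (short m≤j t)     = ++-linear 0ᵥ-linear (embed-linear t)

  read-linear : ∀ {j bs k} (t : Tops j bs k) → Linear (read t)
  read-linear []                     = []-linear
  read-linear (long {b} {bs} j<m t)  = ◂-linear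
    where
    lin : Linear (read t ∘ (_∘ (size b ↑ʳ_)))
    lin = read-linear t ∘ₗ reindex-linear (size b ↑ʳ_)
    ◂-linear : Linear (read (long {b = b} j<m t))
    ◂-linear .cong   e zero      = e (last j<m ↑ˡ dim bs)
    ◂-linear .cong   e (suc i)   = lin .cong e i
    ◂-linear .+-homo x y zero    = refl
    ◂-linear .+-homo x y (suc i) = lin .+-homo x y i
    ◂-linear .*-homo a x zero    = refl
    ◂-linear .*-homo a x (suc i) = lin .*-homo a x i
  read-linear (short {b} m≤j t)      = read-linear t ∘ₗ reindex-linear (size b ↑ʳ_)

  module _ {j b bs k} (j<m : j < size b) (t : Tops j bs k) (c : V (suc k)) where

    embed-long-↑ˡ : ∀ l → fold (embed (long {b = b} j<m t) c) (nilpotent (b ∷ bs)) l ∘ (_↑ˡ dim bs) ≋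
                          c zero *ᵥ e[ l ℕ.+ top j<m ]
    embed-long-↑ˡ l = ≋-trans
      (nilpotent^-↑ˡ b bs l (λ i → reflexive (Vec.lookup-++ˡ _ (embed t (c ∘ suc)) i)))
      (shift^-e l (top j<m) (c zero))

    embed-long-↑ʳ : ∀ l → fold (embed (long {b = b} j<m t) c) (nilpotent (b ∷ bs)) l ∘ (size b ↑ʳ_) ≋
                          fold (embed t (c ∘ suc)) (nilpotent bs) l
    embed-long-↑ʳ l = nilpotent^-↑ʳ b bs l
      (λ i → reflexive (Vec.lookup-++ʳ {m = size b} (c zero *ᵥ e[ top j<m ]) (embed t (c ∘ suc)) i))

  embed-short-↑ʳ : ∀ {j b bs k} (m≤j : size b ≤ j) (t : Tops j bs k) c l →
                   fold (embed (short {b = b} m≤j t) c) (nilpotent (b ∷ bs)) l ∘ (size b ↑ʳ_) ≋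
                   fold (embed t c) (nilpotent bs) l
  embed-short-↑ʳ {b = b} {bs} m≤j t c l = nilpotent^-↑ʳ b bs l
    (λ i → reflexive (Vec.lookup-++ʳ {m = size b} 0ᵥ (embed t c) i))

  -- In a long block, j shifts bring the chosen basis vector to the last place and one more pushes
  -- it out. In a short block the power j + 1 of the shift is zero.
  embed-kernel : ∀ {j bs k} (t : Tops j bs k) c →
                 nilpotent bs (fold (embed t c) (nilpotent bs) j) ≋ 0ᵥ
  embed-kernel []                       c ()
  embed-kernel {j} (long {b} {bs} j<m t) c = ↑-cases
    (λ i → begin
      _                                     ≈⟨ embed-long-↑ˡ {b = b} j<m t c (suc j) i ⟩
      c zero * e[ suc (j ℕ.+ top j<m) ] i   ≡⟨ ≡.cong (λ m → c zero * e[ m ] i) (j+top<m j<m) ⟩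
      c zero * e[ size b ] i                ≈⟨ *-congˡ (e-overflow (size b) i) ⟩
      c zero * 0#                           ≈⟨ zeroʳ _ ⟩
      0#                                    ∎)
    (≋-trans (embed-long-↑ʳ {b = b} j<m t c (suc j)) (embed-kernel t (c ∘ suc)))
  embed-kernel {j} (short {b} {bs} m≤j t) c = ↑-cases
    (λ i → trans (nilpotent^-↑ˡ b bs (suc j) ≋-refl i)
      (shift^-low (suc j) _ i (ℕ.≤-trans (Fin.toℕ<n i) (ℕ.m≤n⇒m≤1+n m≤j))))
    (≋-trans (embed-short-↑ʳ {b = b} m≤j t c (suc j)) (embed-kernel t c))

  -- After j shifts the coefficient of a long block stands in the last coordinate of that block,
  -- where it can be read off.
  embed-injective : ∀ {j bs k} (t : Tops j bs k) c →
                    fold (embed t c) (nilpotent bs) j ≋ 0ᵥ → c ≋ 0ᵥ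
  embed-injective {j} (long {b} {bs} j<m t) c e zero = begin
    c zero                                          ≈⟨ *-identityʳ _ ⟨
    c zero * 1#                                     ≈⟨ *-congˡ (δ-refl (j ℕ.+ top j<m)) ⟨
    c zero * δ (j ℕ.+ top j<m) (j ℕ.+ top j<m)      ≡⟨ ≡.cong (λ l → c zero * δ (j ℕ.+ top j<m) l) (toℕ-last j<m) ⟨
    c zero * e[ j ℕ.+ top j<m ] (last j<m)          ≈⟨ embed-long-↑ˡ {b = b} j<m t c j (last j<m) ⟨
    _                                               ≈⟨ e (last j<m ↑ˡ dim bs) ⟩
    0#                                              ∎
  embed-injective {j} (long {b} j<m t) c e (suc i) = embed-injective t (c ∘ suc)
    (≋-trans (≋-sym (embed-long-↑ʳ {b = b} j<m t c j)) (e ∘ (size b ↑ʳ_))) i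
  embed-injective {j} (short {b} m≤j t) c e = embed-injective t c
    (≋-trans (≋-sym (embed-short-↑ʳ {b = b} m≤j t c j)) (e ∘ (size b ↑ʳ_)))

  -- On a long block, a vector killed by the shift is determined by its last coordinate, which
  -- `read` selects. On a short block, the image of the j-th power is already zero.
  read-injective : ∀ {j bs k} (t : Tops j bs k) u w → w ≋ fold u (nilpotent bs) j →
                   nilpotent bs w ≋ 0ᵥ → read t w ≋ 0ᵥ → w ≋ 0ᵥ
  read-injective []                        u w w≋Nʲu Nw≋0 rw≋0 ()
  read-injective {j} (long {b} {bs} j<m t) u w w≋Nʲu Nw≋0 rw≋0 = ↑-cases
    (shift-kernel _ (last j<m) (≡.trans (≡.cong suc (toℕ-last j<m)) (j+top<m j<m))
      (λ i → trans (reflexive (≡.sym (nilpotent-↑ˡ b bs w i))) (Nw≋0 (i ↑ˡ dim bs)))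
      (rw≋0 zero))
    (read-injective t (u ∘ (size b ↑ʳ_)) _
      (≋-trans (w≋Nʲu ∘ (size b ↑ʳ_)) (nilpotent^-↑ʳ b bs j ≋-refl))
      (λ i → trans (reflexive (≡.sym (nilpotent-↑ʳ b bs w i))) (Nw≋0 (size b ↑ʳ i)))
      (rw≋0 ∘ suc))
  read-injective {j} (short {b} {bs} m≤j t) u w w≋Nʲu Nw≋0 rw≋0 = ↑-cases
    (λ i → trans (w≋Nʲu (i ↑ˡ dim bs)) (trans (nilpotent^-↑ˡ b bs j ≋-refl i)
      (shift^-low j _ i (ℕ.≤-trans (Fin.toℕ<n i) m≤j))))
    (read-injective t (u ∘ (size b ↑ʳ_)) _
      (≋-trans (w≋Nʲu ∘ (size b ↑ʳ_)) (nilpotent^-↑ʳ b bs j ≋-refl))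
      (λ i → trans (reflexive (≡.sym (nilpotent-↑ʳ b bs w i))) (Nw≋0 (size b ↑ʳ i)))
      rw≋0)

  -- Since `f` intertwines the nilpotent parts, it maps ker N ∩ im N ^ j into the corresponding
  -- subspace for `bs′`. Hence the composite of `embed`, N ^ j, `f` and `read` is an injective
  -- linear map from `V k` to `V k′`.
  tops-≤ : IsField → ∀ {bs bs′ j k k′} {f : V (dim bs) → V (dim bs′)} → Linear f →
           (∀ v → f v ≋ 0ᵥ → v ≋ 0ᵥ) →
           (∀ v → f (nilpotent bs v) ≋ nilpotent bs′ (f v)) →
           Tops j bs k → Tops j bs′ k′ → k ≤ k′
  tops-≤ F {bs} {bs′} {j} {f = f} lf inj comm t t′ = injective⇒≤ F
    (read-linear t′ ∘ₗ lf ∘ₗ fold-linear (nilpotent-linear bs) j ∘ₗ embed-linear t)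
    (λ c e → embed-injective t c (inj _ (read-injective t′ (f (embed t c)) _
      (fold-commute (nilpotent-linear bs′) comm j (embed t c))
      (≋-trans (≋-sym (comm _)) (≋-trans (lf .cong (embed-kernel t c)) (0-homo lf)))
      e)))

  -- Unipotent Jordan matrices: invariance of the block counts and of the eigenvalue.

  Unipotent : List Block → Set _
  Unipotent = All (λ b → eigenvalue b ≈ 1#)

  eigenvalues≋1 : ∀ {bs} → Unipotent bs → eigenvalues bs ≋ replicate _ 1#
  eigenvalues≋1 []                        ()
  eigenvalues≋1 {b ∷ bs} (e ∷ es) = ↑-cases
    (λ i → trans (reflexive (eigenvalues-↑ˡ b bs i)) e)
    (λ i → trans (reflexive (eigenvalues-↑ʳ b bs i)) (eigenvalues≋1 es i))

  unipotent-· : ∀ {bs} → Unipotent bs → ∀ v → jordanMatrix bs · v ≋ v +ᵥ nilpotent bs v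
  unipotent-· {bs} es v i = trans (jordanMatrix-· bs v i)
    (+-congʳ (trans (*-congʳ (eigenvalues≋1 es i)) (*-identityˡ _)))

  -- Both matrices have the form 1 + N, so an isomorphism that intertwines them also intertwines the
  -- nilpotent parts, by cancelling the identity.
  ∼⇒tops-≤ : IsField → ∀ {bs bs′ j k k′} → jordanMatrix bs ∼ jordanMatrix bs′ →
             Unipotent bs → Unipotent bs′ → Tops j bs k → Tops j bs′ k′ → k ≤ k′
  ∼⇒tops-≤ F {bs} {bs′} J∼J′ es es′ = tops-≤ F to-linear to-injective λ v i →
    ∙-cancelˡ (to v i) _ _ (begin
      to v i + to (nilpotent bs v) i    ≈⟨ to-linear .+-homo v _ i ⟨
      to (v +ᵥ nilpotent bs v) i        ≈⟨ to-linear .cong (unipotent-· es v) i ⟨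
      to (jordanMatrix bs · v) i        ≈⟨ commute v i ⟩
      (jordanMatrix bs′ · to v) i       ≈⟨ unipotent-· es′ (to v) i ⟩
      to v i + nilpotent bs′ (to v) i   ∎)
    where open _∼_ J∼J′

  tops-unique : IsField → ∀ {bs bs′ j k k′} → jordanMatrix bs ∼ jordanMatrix bs′ →
                Unipotent bs → Unipotent bs′ → Tops j bs k → Tops j bs′ k′ → k ≡ k′
  tops-unique F J∼J′ es es′ t t′ = ℕ.≤-antisym
    (∼⇒tops-≤ F J∼J′ es es′ t t′) (∼⇒tops-≤ F (∼-sym J∼J′) es′ es t′ t)

  -- The last basis vector of the block, extended by zero. Its coordinate equal to 1 is recorded as
  -- evidence that it is non-zero.
  eigenvector : ∀ {bs b} → b ∈ bs → ∃ λ w →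
                jordanMatrix bs · w ≋ eigenvalue b *ᵥ w × ∃ λ i → w i ≈ 1#
  eigenvector {bs} b∈bs = let w , Jw≋μw , w≉0 = eigen b∈bs in
    w , ≋-trans (jordanMatrix-· bs w) Jw≋μw , w≉0
    where
    eigen : ∀ {bs b} → b ∈ bs → ∃ λ w →
            (λ i → eigenvalues bs i * w i + nilpotent bs w i) ≋ eigenvalue b *ᵥ w ×
            ∃ λ i → w i ≈ 1#
    eigen {b ∷ bs} (here ≡.refl) = w , ↑-cases
      (λ i → trans (+-cong (*-congʳ (reflexive (eigenvalues-↑ˡ b bs i)))
        (trans (reflexive (nilpotent-↑ˡ b bs w i))
          (trans (shift-linear .cong wˡ i)
            (trans (shift-e (top 0<m) i)
              (trans (reflexive (≡.cong (λ m → e[ m ] i) (j+top<m 0<m))) (e-overflow (size b) i))))))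
        (+-identityʳ _))
      (λ i → trans (+-cong
          (trans (*-congˡ (wʳ i)) (zeroʳ _))
          (trans (reflexive (nilpotent-↑ʳ b bs w i))
            (trans (nilpotent-linear bs .cong wʳ i) (0-homo (nilpotent-linear bs) i))))
        (trans (+-identityʳ _) (sym (trans (*-congˡ (wʳ i)) (zeroʳ _))))) ,
      last 0<m ↑ˡ dim bs ,
      trans (wˡ (last 0<m)) (trans (reflexive (≡.cong (δ (top 0<m)) (toℕ-last 0<m))) (δ-refl (top 0<m)))
      where
      0<m : 0 < size b
      0<m = ℕ.>-nonZero⁻¹ (size b)
      -- For j = 0, `top` is the index of the last coordinate; it exists because block sizes are
      -- non-zero.
      w : V (dim (b ∷ bs))
      w = _++_ {m = size b} e[ top 0<m ] 0ᵥ
      wˡ : w ∘ (_↑ˡ dim bs) ≋ e[ top 0<m ]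
      wˡ i = reflexive (Vec.lookup-++ˡ e[ top 0<m ] (0ᵥ {dim bs}) i)
      wʳ : w ∘ (size b ↑ʳ_) ≋ 0ᵥ
      wʳ i = reflexive (Vec.lookup-++ʳ {m = size b} e[ top 0<m ] 0ᵥ i)
    eigen {b ∷ bs} {b′} (there b′∈bs) with eigen b′∈bs
    ... | w , Jw≋μw , i₀ , wi₀≈1 = 0w , ↑-cases
      (λ i → trans (+-cong
          (trans (*-congˡ (0wˡ i)) (zeroʳ _))
          (trans (reflexive (nilpotent-↑ˡ b bs 0w i))
            (trans (shift-linear .cong 0wˡ i) (0-homo shift-linear i))))
        (trans (+-identityʳ _) (sym (trans (*-congˡ (0wˡ i)) (zeroʳ _)))))
      (λ i → trans (+-cong
          (*-cong (reflexive (eigenvalues-↑ʳ b bs i)) (0wʳ i))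
          (trans (reflexive (nilpotent-↑ʳ b bs 0w i)) (nilpotent-linear bs .cong 0wʳ i)))
        (trans (Jw≋μw i) (*-congˡ (sym (0wʳ i))))) ,
      size b ↑ʳ i₀ , trans (0wʳ i₀) wi₀≈1
      where
      0w : V (dim (b ∷ bs))
      0w = _++_ {m = size b} 0ᵥ w
      0wˡ : 0w ∘ (_↑ˡ dim bs) ≋ 0ᵥ
      0wˡ i = reflexive (Vec.lookup-++ˡ {m = size b} 0ᵥ w i)
      0wʳ : 0w ∘ (size b ↑ʳ_) ≋ w
      0wʳ i = reflexive (Vec.lookup-++ʳ {m = size b} 0ᵥ w i)

  -- Coordinate 0 of a shifted vector is zero, and every further coordinate of `w` is a multiple of
  -- the one before it.
  shift-eigen : ∀ {n} a {w : V n} → w ≋ a *ᵥ shift w → w ≋ 0ᵥ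
  shift-eigen a {w} e i = go (suc (toℕ i)) i ℕ.≤-refl
    where
    -- The bound `j` makes the recursion structural, since `inject₁ i` is not a subterm of `suc i`.
    go : ∀ j i → toℕ i < j → w i ≈ 0#
    go j       zero    i<j       = trans (e zero) (zeroʳ a)
    go (suc j) (suc i) (s≤s i<j) = trans (e (suc i)) (trans (*-congˡ
      (go j (inject₁ i) (≡.subst (_< j) (≡.sym (Fin.toℕ-inject₁ i)) i<j))) (zeroʳ a))

  nilpotent-eigen : ∀ bs a {w} → w ≋ a *ᵥ nilpotent bs w → w ≋ 0ᵥ
  nilpotent-eigen []       a e ()
  nilpotent-eigen (b ∷ bs) a {w} e = ↑-cases
    (shift-eigen a (λ i → trans (e (i ↑ˡ dim bs)) (*-congˡ (reflexive (nilpotent-↑ˡ b bs w i)))))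
    (nilpotent-eigen bs a (λ i → trans (e (size b ↑ʳ i)) (*-congˡ (reflexive (nilpotent-↑ʳ b bs w i)))))

  -- An eigenvector for μ is carried to some w′ with (μ - 1) w′ = N′ w′. If μ - 1 had an inverse y,
  -- then w′ = y N′ w′ would vanish by nilpotency, although the eigenvector does not.
  unipotent-∼ : IsField → ∀ {bs bs′} → jordanMatrix bs ∼ jordanMatrix bs′ →
                Unipotent bs′ → Unipotent bs
  unipotent-∼ F {bs} {bs′} J∼J′ es = All.tabulate go
    where
    open _∼_ J∼J′
    go : ∀ {b} → b ∈ bs → eigenvalue b ≈ 1#
    go {b} b∈bs with eigenvector b∈bs | IsField.zeroOrUnit F (eigenvalue b - 1#)
    ... | _ | inj₁ μ-1≈0 = x∙y⁻¹≈ε⇒x≈y _ _ μ-1≈0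
    ... | w , Jw≋μw , i , wi≈1 | inj₂ (y , unit) =
      contradiction (trans (sym wi≈1) (to-injective w w′≋0 i)) (IsField.1≉0 F)
      where
      w′ = to w
      μ = eigenvalue b
      N′w′ : ∀ i → (μ - 1#) * w′ i ≈ nilpotent bs′ w′ i
      N′w′ i = ∙-cancelˡ (w′ i) _ _ (begin
        w′ i + (μ - 1#) * w′ i            ≈⟨ +-congʳ (*-identityˡ _) ⟨
        1# * w′ i + (μ - 1#) * w′ i       ≈⟨ distribʳ _ _ _ ⟨
        (1# + (μ - 1#)) * w′ i            ≈⟨ *-congʳ (trans (+-comm _ _) (trans (+-assoc _ _ _) (trans (+-congˡ (-‿inverseˡ 1#)) (+-identityʳ μ)))) ⟩
        μ * w′ i                          ≈⟨ to-linear .*-homo μ w i ⟨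
        to (μ *ᵥ w) i                     ≈⟨ to-linear .cong Jw≋μw i ⟨
        to (jordanMatrix bs · w) i        ≈⟨ commute w i ⟩
        (jordanMatrix bs′ · w′) i         ≈⟨ unipotent-· es w′ i ⟩
        w′ i + nilpotent bs′ w′ i         ∎)
      w′≋0 : w′ ≋ 0ᵥ
      w′≋0 = nilpotent-eigen bs′ y (λ i → begin
        w′ i                       ≈⟨ *-identityˡ _ ⟨
        1# * w′ i                  ≈⟨ *-congʳ (trans (*-comm _ _) unit) ⟨
        y * (μ - 1#) * w′ i        ≈⟨ *-assoc _ _ _ ⟩
        y * ((μ - 1#) * w′ i)      ≈⟨ *-congˡ (N′w′ i) ⟩
        y * nilpotent bs′ w′ i     ∎)

-- Rescaled Stirling numbers over a commutative ring.

module Stirling {c ℓ} (R : CommutativeRing c ℓ) where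

  open CommutativeRing R hiding (zero)
  open LinearAlgebra R
  open JordanForm R
  open import Algebra.Properties.Semiring.Sum semiring
  open import Algebra.Properties.Ring ring using (-‿distribˡ-*)
  open import Algebra.Properties.AbelianGroup +-abelianGroup using (⁻¹-∙-comm)
  open import Algebra.Solver.Ring.NaturalCoefficients.Default commutativeSemiring
    using (solve; _:=_; _:+_; _:*_)
  open import Data.Vec.Functional.Relation.Binary.Equality.Setoid setoid using (_≋_)
  open import Relation.Binary.Reasoning.Setoid setoid

  -- Rows of triangular matrices are kept as infinite sequences, so that recursion on the degree is
  -- independent of the matrix size.
  Seq : Set c
  Seq = ℕ → Carrier

  infix 4 _≗_
  _≗_ : Seq → Seq → Set ℓ
  f ≗ g = ∀ i → f i ≈ g i

  -- On coefficient sequences of polynomials this is multiplication by x.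
  delay : Seq → Seq
  delay f zero    = 0#
  delay f (suc i) = f i

  Σ[_] : ℕ → Seq → Carrier
  Σ[ zero  ] f = 0#
  Σ[ suc n ] f = f 0 + Σ[ n ] (f ∘ suc)

  sum≡Σ : ∀ n f → ∑[ k < n ] f (toℕ k) ≡ Σ[ n ] f
  sum≡Σ zero    f = ≡.refl
  sum≡Σ (suc n) f = ≡.cong (λ z → f 0 + z) (sum≡Σ n (f ∘ suc))

  Σ-cong : ∀ n {f g} → f ≗ g → Σ[ n ] f ≈ Σ[ n ] g
  Σ-cong zero    e = refl
  Σ-cong (suc n) e = +-cong (e 0) (Σ-cong n (e ∘ suc))

  Σ-+ : ∀ n f g → Σ[ n ] (λ k → f k + g k) ≈ Σ[ n ] f + Σ[ n ] g
  Σ-+ n f g rewrite ≡.sym (sum≡Σ n f) | ≡.sym (sum≡Σ n g) | ≡.sym (sum≡Σ n (λ k → f k + g k)) =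
    ∑-distrib-+ {n} (f ∘ toℕ) (g ∘ toℕ)

  Σ-* : ∀ n a f → Σ[ n ] (λ k → a * f k) ≈ a * Σ[ n ] f
  Σ-* n a f rewrite ≡.sym (sum≡Σ n f) | ≡.sym (sum≡Σ n (λ k → a * f k)) =
    sym (*-distribˡ-sum {n} a (f ∘ toℕ))

  Σ-last : ∀ n f → f n ≈ 0# → Σ[ suc n ] f ≈ Σ[ n ] f
  Σ-last zero    f f0≈0 = trans (+-identityʳ _) f0≈0
  Σ-last (suc n) f fn≈0 = +-congˡ (Σ-last n (f ∘ suc) fn≈0)

  -- Reindexing drops the term at n - 1, which vanishes because `f` is supported on indices up to i.
  Σ-delay : ∀ {n i} (f w : Seq) → suc i < n → (∀ k → i < k → f k ≈ 0#) →
            Σ[ n ] (λ k → delay f k * w k) ≈ Σ[ n ] (λ k → f k * w (suc k))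
  Σ-delay {suc n} f w (s≤s i<n) f-upper = begin
    0# * w 0 + Σ[ n ] (λ k → f k * w (suc k))  ≈⟨ +-congʳ (zeroˡ _) ⟩
    0# + Σ[ n ] (λ k → f k * w (suc k))        ≈⟨ +-identityˡ _ ⟩
    Σ[ n ] (λ k → f k * w (suc k))             ≈⟨ Σ-last n _ (trans (*-congʳ (f-upper n i<n)) (zeroˡ _)) ⟨
    Σ[ suc n ] (λ k → f k * w (suc k))         ∎

  Σ-δ0 : ∀ {n} (w : Seq) → 0 < n → Σ[ n ] (λ k → δ 0 k * w k) ≈ w 0
  Σ-δ0 {suc n} w _ = begin
    1# * w 0 + Σ[ n ] (λ k → 0# * w (suc k))  ≈⟨ +-cong (*-identityˡ _) (trans (Σ-* n 0# (w ∘ suc)) (zeroˡ _)) ⟩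
    w 0 + 0#                                  ≈⟨ +-identityʳ _ ⟩
    w 0                                       ∎

  1ₘ-δ : ∀ {n} (i j : Fin n) → 1ₘ i j ≈ δ (toℕ i) (toℕ j)
  1ₘ-δ zero    zero    = refl
  1ₘ-δ zero    (suc j) = refl
  1ₘ-δ (suc i) zero    = refl
  1ₘ-δ (suc i) (suc j) = 1ₘ-δ i j

  -- The expected Jordan form, and its nilpotent part in terms of sequences.

  blocks : (p q r : ℕ) .{{_ : NonZero p}} → List Block
  blocks p       zero    zero    = []
  blocks p       zero    (suc r) = block (suc r) 1# ∷ []
  blocks (suc p) (suc q) r       = block (suc p) 1# ∷ blocks (suc p) q r

  blocks-unipotent : ∀ p q r .{{_ : NonZero p}} → Unipotent (blocks p q r)
  blocks-unipotent p       zero    zero    = []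
  blocks-unipotent p       zero    (suc r) = refl ∷ []
  blocks-unipotent (suc p) (suc q) r       = refl ∷ blocks-unipotent (suc p) q r

  dim-blocks : ∀ p q r .{{_ : NonZero p}} → dim (blocks p q r) ≡ q ℕ.* p ℕ.+ r
  dim-blocks p       zero    zero    = ≡.refl
  dim-blocks p       zero    (suc r) = ≡.cong suc (ℕ.+-identityʳ r)
  dim-blocks (suc p) (suc q) r       =
    ≡.trans (≡.cong (suc p ℕ.+_) (dim-blocks (suc p) q r)) (≡.sym (ℕ.+-assoc (suc p) _ r))

  -- Among the first m ≤ p indices only 0 is a multiple of p, so no interruption occurs inside a
  -- block.
  shift-toℕ : ∀ {m p} → m ≤ p → (f g : Seq) → (∀ i → p ∣ i → g i ≈ 0#) →
              (∀ i → ¬ p ∣ suc i → g (suc i) ≈ f i) →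
              ∀ (i : Fin m) → shift (f ∘ toℕ) i ≈ g (toℕ i)
  shift-toℕ     m≤p f g multiple coprime zero    = sym (multiple 0 (_ ∣0))
  shift-toℕ {p = p} m≤p f g multiple coprime (suc i) = trans
    (reflexive (≡.cong f (Fin.toℕ-inject₁ i)))
    (sym (coprime (toℕ i) (λ p∣1+i → ℕ.<⇒≱ (ℕ.<-≤-trans (Fin.toℕ<n (suc i)) m≤p) (∣⇒≤ p∣1+i))))

  -- The sequence `g` is `f` delayed by one place and erased at the multiples of p, where the blocks
  -- begin. The induction on q translates both sequences by p, which preserves divisibility by p.
  nilpotent-blocks : ∀ p q {r} .{{_ : NonZero p}} → r ≤ p → (f g : Seq) →
                     (∀ i → p ∣ i → g i ≈ 0#) → (∀ i → ¬ p ∣ suc i → g (suc i) ≈ f i) →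
                     nilpotent (blocks p q r) (f ∘ toℕ) ≋ g ∘ toℕ
  nilpotent-blocks p       zero    {zero}  r≤p f g multiple coprime ()
  nilpotent-blocks p       zero    {suc r} r≤p f g multiple coprime = ↑-cases {m = suc r}
    (λ i → begin
      _                                       ≡⟨ nilpotent-↑ˡ (block (suc r) 1#) [] (f ∘ toℕ) i ⟩
      shift (λ i → f (toℕ (i ↑ˡ 0))) i        ≈⟨ shift-linear .Linear.cong (λ i → reflexive (≡.cong f (Fin.toℕ-↑ˡ i 0))) i ⟩
      shift (f ∘ toℕ) i                       ≈⟨ shift-toℕ r≤p f g multiple coprime i ⟩
      g (toℕ i)                               ≡⟨ ≡.cong g (Fin.toℕ-↑ˡ i 0) ⟨
      g (toℕ (i ↑ˡ 0))                        ∎)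
    (λ ())
  nilpotent-blocks p@(suc _) (suc q) {r} r≤p f g multiple coprime = ↑-cases {m = p}
    (λ i → begin
      _                                       ≡⟨ nilpotent-↑ˡ b bs (f ∘ toℕ) i ⟩
      shift (λ i → f (toℕ (i ↑ˡ dim bs))) i   ≈⟨ shift-linear .Linear.cong (λ i → reflexive (≡.cong f (Fin.toℕ-↑ˡ i (dim bs)))) i ⟩
      shift (f ∘ toℕ) i                       ≈⟨ shift-toℕ ℕ.≤-refl f g multiple coprime i ⟩
      g (toℕ i)                               ≡⟨ ≡.cong g (Fin.toℕ-↑ˡ i (dim bs)) ⟨
      g (toℕ (i ↑ˡ dim bs))                   ∎)
    (λ i → begin
      _                                       ≡⟨ nilpotent-↑ʳ b bs (f ∘ toℕ) i ⟩
      nilpotent bs (λ i → f (toℕ (p ↑ʳ i))) i ≈⟨ nilpotent-linear bs .Linear.cong (λ i → reflexive (≡.cong f (Fin.toℕ-↑ʳ p i))) i ⟩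
      nilpotent bs (f ∘ (p ℕ.+_) ∘ toℕ) i     ≈⟨ nilpotent-blocks p q r≤p (f ∘ (p ℕ.+_)) (g ∘ (p ℕ.+_))
                                                   (λ k p∣k → multiple (p ℕ.+ k) (∣m∣n⇒∣m+n ∣-refl p∣k))
                                                   (λ k p∤k → trans (reflexive (≡.cong g (ℕ.+-suc p k)))
                                                     (coprime (p ℕ.+ k) (λ p∣ → p∤k (∣m+n∣m⇒∣n
                                                       (≡.subst (p ∣_) (≡.sym (ℕ.+-suc p k)) p∣) ∣-refl)))) i ⟩
      g (p ℕ.+ toℕ i)                         ≡⟨ ≡.cong g (Fin.toℕ-↑ʳ p i) ⟨
      g (toℕ (p ↑ʳ i))                        ∎)
    where
    b = block p 1#
    bs = blocks p q r

  -- `ι` is the canonical map from the natural numbers, and `lam i` is a unit with inverse `kap i`.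
  -- Modulo p, `lam i` will be i itself when p does not divide i, and 1 otherwise.
  record Scaling (ι lam kap : Seq) : Set ℓ where
    field
      ι-0      : ι 0 ≈ 0#
      ι-1      : ι 1 ≈ 1#
      ι-+      : ∀ m n → ι (m ℕ.+ n) ≈ ι m + ι n
      inverse  : ∀ i → kap i * lam i ≈ 1#

  -- The change of basis to rescaled falling factorials and its inverse.

  module _ {ι lam kap : Seq} (scaling : Scaling ι lam kap) where

    open Scaling scaling

    -- Row i lists the coefficients of the falling factorial of degree i, up to
    -- the unit kap 1 ⋯ kap i.
    u : ℕ → Seq
    u zero    c = δ 0 c
    u (suc i) c = kap (suc i) * (delay (u i) c + - ι i * u i c)

    -- Row j lists the coordinates of the monomial of degree j in the basis u.
    v : ℕ → Seq
    v zero    i = δ 0 i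
    v (suc j) i = lam i * delay (v j) i + ι i * v j i

    u-upper : ∀ i c → i < c → u i c ≈ 0#
    u-upper zero    (suc c) i<c       = refl
    u-upper (suc i) (suc c) (s≤s i<c) = trans (*-congˡ (trans (+-cong (u-upper i c i<c)
        (trans (*-congˡ (u-upper i (suc c) (ℕ.m<n⇒m<1+n i<c))) (zeroʳ _)))
      (+-identityˡ 0#))) (zeroʳ _)

    v-upper : ∀ j i → j < i → v j i ≈ 0#
    v-upper zero    (suc i) j<i       = refl
    v-upper (suc j) (suc i) (s≤s j<i) = trans (+-cong
        (trans (*-congˡ (v-upper j i j<i)) (zeroʳ _))
        (trans (*-congˡ (v-upper j (suc i) (ℕ.m<n⇒m<1+n j<i))) (zeroʳ _)))
      (+-identityˡ 0#)

    -- The linear functional sending x ^ k to w k, evaluated at row i of u.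
    φ : ℕ → Seq → Carrier
    φ zero    w = w 0
    φ (suc i) w = kap (suc i) * (φ i (w ∘ suc) + - ι i * φ i w)

    -- The linear functional sending row k of u to w k, evaluated at x ^ j.
    ψ : ℕ → Seq → Carrier
    ψ zero    w = w 0
    ψ (suc j) w = ψ j (λ k → lam (suc k) * w (suc k) + ι k * w k)

    -- Row i is supported on indices up to i, so every sum over more than i indices computes the
    -- whole functional. Later inductions can then use `φ` without truncation bounds.
    Σ-u : ∀ {n} i w → i < n → Σ[ n ] (λ k → u i k * w k) ≈ φ i w
    Σ-u     zero    w i<n = Σ-δ0 w i<n
    Σ-u {n} (suc i) w i<n = begin
      Σ[ n ] (λ k → u (suc i) k * w k)
        ≈⟨ Σ-cong n (λ k → distribute κ m (delay (u i) k) (u i k) (w k)) ⟩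
      Σ[ n ] (λ k → κ * (delay (u i) k * w k + m * (u i k * w k)))
        ≈⟨ Σ-* n κ _ ⟩
      κ * Σ[ n ] (λ k → delay (u i) k * w k + m * (u i k * w k))
        ≈⟨ *-congˡ (trans (Σ-+ n _ _) (+-congˡ (Σ-* n m _))) ⟩
      κ * (Σ[ n ] (λ k → delay (u i) k * w k) + m * Σ[ n ] (λ k → u i k * w k))
        ≈⟨ *-congˡ (+-cong (trans (Σ-delay (u i) w i<n (u-upper i))
                                  (Σ-u i (w ∘ suc) (ℕ.<-trans (ℕ.n<1+n i) i<n)))
                           (*-congˡ (Σ-u i w (ℕ.<-trans (ℕ.n<1+n i) i<n)))) ⟩
      φ (suc i) w ∎
      where
      κ m : Carrier
      κ = kap (suc i)
      m = - ι i
      distribute : ∀ κ m d u w → (κ * (d + m * u)) * w ≈ κ * (d * w + m * (u * w))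
      distribute = solve 5 (λ κ m d u w → (κ :* (d :+ m :* u)) :* w := κ :* (d :* w :+ m :* (u :* w))) refl

    Σ-v : ∀ {n} j w → j < n → Σ[ n ] (λ k → v j k * w k) ≈ ψ j w
    Σ-v     zero    w j<n = Σ-δ0 w j<n
    Σ-v {n} (suc j) w j<n = begin
      Σ[ n ] (λ k → v (suc j) k * w k)
        ≈⟨ Σ-cong n (λ k → regroup (lam k) (ι k) (delay (v j) k) (v j k) (w k)) ⟩
      Σ[ n ] (λ k → delay (v j) k * (lam k * w k) + v j k * (ι k * w k))
        ≈⟨ Σ-+ n _ _ ⟩
      Σ[ n ] (λ k → delay (v j) k * (lam k * w k)) + Σ[ n ] (λ k → v j k * (ι k * w k))
        ≈⟨ +-congʳ (Σ-delay (v j) _ j<n (v-upper j)) ⟩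
      Σ[ n ] (λ k → v j k * (lam (suc k) * w (suc k))) + Σ[ n ] (λ k → v j k * (ι k * w k))
        ≈⟨ Σ-+ n _ _ ⟨
      Σ[ n ] (λ k → v j k * (lam (suc k) * w (suc k)) + v j k * (ι k * w k))
        ≈⟨ Σ-cong n (λ k → distribˡ _ _ _) ⟨
      Σ[ n ] (λ k → v j k * (lam (suc k) * w (suc k) + ι k * w k))
        ≈⟨ Σ-v j _ (ℕ.<-trans (ℕ.n<1+n j) j<n) ⟩
      ψ (suc j) w ∎
      where
      regroup : ∀ l i d v w → (l * d + i * v) * w ≈ d * (l * w) + v * (i * w)
      regroup = solve 5 (λ l i d v w → (l :* d :+ i :* v) :* w := d :* (l :* w) :+ v :* (i :* w)) refl

    φ-cong : ∀ i {w x} → w ≗ x → φ i w ≈ φ i x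
    φ-cong zero    e = e 0
    φ-cong (suc i) e = *-congˡ (+-cong (φ-cong i (e ∘ suc)) (*-congˡ (φ-cong i e)))

    φ-+ : ∀ i w x → φ i (λ k → w k + x k) ≈ φ i w + φ i x
    φ-+ zero    w x = refl
    φ-+ (suc i) w x = trans
      (*-congˡ (+-cong (φ-+ i (w ∘ suc) (x ∘ suc)) (*-congˡ (φ-+ i w x))))
      (solve 6 (λ κ m a b c d → κ :* ((a :+ b) :+ m :* (c :+ d)) :=
                                κ :* (a :+ m :* c) :+ κ :* (b :+ m :* d)) refl
        (kap (suc i)) (- ι i) (φ i (w ∘ suc)) (φ i (x ∘ suc)) (φ i w) (φ i x))

    φ-* : ∀ i a w → φ i (λ k → a * w k) ≈ a * φ i w
    φ-* zero    a w = refl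
    φ-* (suc i) a w = trans
      (*-congˡ (+-cong (φ-* i a (w ∘ suc)) (*-congˡ (φ-* i a w))))
      (solve 5 (λ κ m a b c → κ :* (a :* b :+ m :* (a :* c)) := a :* (κ :* (b :+ m :* c))) refl
        (kap (suc i)) (- ι i) a (φ i (w ∘ suc)) (φ i w))

    φ-0 : ∀ i → φ i (λ _ → 0#) ≈ 0#
    φ-0 zero    = refl
    φ-0 (suc i) = trans (*-congˡ (trans (+-cong (φ-0 i) (trans (*-congˡ (φ-0 i)) (zeroʳ _)))
                                        (+-identityˡ 0#))) (zeroʳ _)

    ψ-cong : ∀ j {w x} → w ≗ x → ψ j w ≈ ψ j x
    ψ-cong zero    e = e 0
    ψ-cong (suc j) e = ψ-cong j (λ k → +-cong (*-congˡ (e (suc k))) (*-congˡ (e k)))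

    ψ-0 : ∀ j → ψ j (λ _ → 0#) ≈ 0#
    ψ-0 zero    = refl
    ψ-0 (suc j) = trans (ψ-cong j (λ k → trans (+-cong (zeroʳ _) (zeroʳ _)) (+-identityˡ 0#))) (ψ-0 j)

    a*x-a*x : ∀ a x → a * x + - a * x ≈ 0#
    a*x-a*x a x = trans (+-congˡ (sym (-‿distribˡ-* a x))) (-‿inverseʳ _)

    δ-ι : ∀ i c → ι c * δ i c + - ι i * δ i c ≈ 0#
    δ-ι i c with i ℕ.≟ c
    ... | yes ≡.refl = a*x-a*x (ι i) (δ i i)
    ... | no  i≢c    = trans (+-cong (trans (*-congˡ (δ-≢ i c i≢c)) (zeroʳ _))
                                     (trans (*-congˡ (δ-≢ i c i≢c)) (zeroʳ _))) (+-identityˡ 0#)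

    inverse-δ : ∀ i c → kap i * lam c * δ i c ≈ δ i c
    inverse-δ i c with i ℕ.≟ c
    ... | yes ≡.refl = trans (*-congʳ (inverse i)) (*-identityˡ _)
    ... | no  i≢c    = trans (trans (*-congˡ (δ-≢ i c i≢c)) (zeroʳ _)) (sym (δ-≢ i c i≢c))

    -- Evaluating row i of `u` on the coordinates of the monomials gives the coordinates of a basis
    -- element in its own basis. In matrix form this is U V = 1.
    φ-v : ∀ i c → φ i (λ k → v k c) ≈ δ i c
    φ-v zero    c = refl
    φ-v (suc i) c = begin
      κ * (φ i (λ k → lam c * delay (v k) c + ι c * v k c) + m * φ i (λ k → v k c))
        ≈⟨ *-congˡ (+-cong (trans (φ-+ i _ _) (+-cong (φ-* i (lam c) _) (trans (φ-* i (ι c) _) (*-congˡ (φ-v i c)))))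
                           (*-congˡ (φ-v i c))) ⟩
      κ * ((lam c * φ i (λ k → delay (v k) c) + ι c * δ i c) + m * δ i c)
        -- The terms with ι c and - ι i cancel: they carry δ i c, which vanishes unless i = c.
        ≈⟨ *-congˡ (trans (+-assoc _ _ _) (trans (+-congˡ (δ-ι i c)) (+-identityʳ _))) ⟩
      κ * (lam c * φ i (λ k → delay (v k) c))
        ≈⟨ *-assoc _ _ _ ⟨
      κ * lam c * φ i (λ k → delay (v k) c)
        ≈⟨ last-step c ⟩
      δ (suc i) c ∎
      where
      κ m : Carrier
      κ = kap (suc i)
      m = - ι i
      last-step : ∀ c → κ * lam c * φ i (λ k → delay (v k) c) ≈ δ (suc i) c
      last-step zero    = trans (*-congˡ (φ-0 i)) (zeroʳ _)
      last-step (suc c) = trans (*-congˡ (φ-v i c)) (inverse-δ (suc i) (suc c))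

    -- This is V U = 1. Solving the recursion of `u` for the delayed row shows that x times row k is
    -- `lam (suc k)` times row k + 1 plus `ι k` times row k, which is the combination that `ψ`
    -- forms.
    ψ-u : ∀ j c → ψ j (λ k → u k c) ≈ δ j c
    ψ-u zero    c = refl
    ψ-u (suc j) c = trans (ψ-cong j (λ k → begin
      lam (suc k) * (kap (suc k) * (delay (u k) c + - ι k * u k c)) + ι k * u k c
        ≈⟨ +-congʳ (*-assoc _ _ _) ⟨
      lam (suc k) * kap (suc k) * (delay (u k) c + - ι k * u k c) + ι k * u k c
        ≈⟨ +-congʳ (trans (*-congʳ (trans (*-comm _ _) (inverse (suc k)))) (*-identityˡ _)) ⟩
      delay (u k) c + - ι k * u k c + ι k * u k c
        ≈⟨ +-assoc _ _ _ ⟩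
      delay (u k) c + (- ι k * u k c + ι k * u k c)
        ≈⟨ +-congˡ (trans (+-comm _ _) (a*x-a*x (ι k) (u k c))) ⟩
      delay (u k) c + 0#
        ≈⟨ +-identityʳ _ ⟩
      delay (u k) c ∎)) (last-step c)
      where
      last-step : ∀ c → ψ j (λ k → delay (u k) c) ≈ δ (suc j) c
      last-step zero    = ψ-0 j
      last-step (suc c) = ψ-u j c

    -- The Pascal matrix in the basis of rescaled falling factorials.

    binomial : ℕ → ℕ → Carrier
    binomial k c = ι (k C c)

    binomial-suc : ∀ k c → binomial (suc k) c ≈ binomial k c + delay (binomial k) c
    binomial-suc k zero    = sym (+-identityʳ _)
    binomial-suc k (suc c) = begin
      ι (suc k C suc c)            ≡⟨ ≡.cong ι (nCk+nC[k+1]≡[n+1]C[k+1] k c) ⟨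
      ι (k C c ℕ.+ k C suc c)      ≈⟨ ι-+ _ _ ⟩
      ι (k C c) + ι (k C suc c)    ≈⟨ +-comm _ _ ⟩
      ι (k C suc c) + ι (k C c)    ∎

    -- After rescaling, the coefficient i of (x)ᵢ₋₁ in (x + 1)ᵢ becomes this one, because rows i and
    -- i - 1 differ by the additional unit `kap i`.
    ρ : ℕ → Carrier
    ρ i = ι i * kap i

    prev : ℕ → Seq
    prev i c = delay (λ k → u k c) i

    ι-suc : ∀ i x → ι (suc i) * x ≈ x + ι i * x
    ι-suc i x = trans (*-congʳ (trans (ι-+ 1 i) (+-congʳ ι-1)))
                      (trans (distribʳ _ _ _) (+-congʳ (*-identityˡ x)))

    -- The factor 1 + x - i equals x - (i - 1), which together with `kap i` turns row i - 1 into row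
    -- i. For i = 0 both sides vanish with `ι 0`.
    ρ-prev : ∀ i c → ρ i * (prev i c + delay (prev i) c + - ι i * prev i c) ≈ ι i * u i c
    ρ-prev zero c = trans (*-congʳ (trans (*-congʳ ι-0) (zeroˡ _)))
      (trans (zeroˡ _) (sym (trans (*-congʳ ι-0) (zeroˡ _))))
    ρ-prev (suc i) c = begin
      ι (suc i) * kap (suc i) * (u i c + delay (u i) c + - ι (suc i) * u i c)
        ≈⟨ *-congˡ (+-congˡ (begin
             - ι (suc i) * u i c               ≈⟨ -‿distribˡ-* _ _ ⟨
             - (ι (suc i) * u i c)             ≈⟨ -‿cong (ι-suc i (u i c)) ⟩
             - (u i c + ι i * u i c)           ≈⟨ ⁻¹-∙-comm _ _ ⟨
             - u i c + - (ι i * u i c)         ≈⟨ +-congˡ (-‿distribˡ-* _ _) ⟩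
             - u i c + - ι i * u i c           ∎)) ⟩
      ι (suc i) * kap (suc i) * (u i c + delay (u i) c + (- u i c + - ι i * u i c))
        ≈⟨ *-congˡ (solve 4 (λ x d y z → x :+ d :+ (y :+ z) := (x :+ y) :+ (d :+ z)) refl
             (u i c) (delay (u i) c) (- u i c) (- ι i * u i c)) ⟩
      ι (suc i) * kap (suc i) * ((u i c + - u i c) + (delay (u i) c + - ι i * u i c))
        ≈⟨ *-congˡ (trans (+-congʳ (-‿inverseʳ _)) (+-identityˡ _)) ⟩
      ι (suc i) * kap (suc i) * (delay (u i) c + - ι i * u i c)
        ≈⟨ *-assoc _ _ _ ⟩
      ι (suc i) * u (suc i) c ∎

    -- The identity (x + 1)ᵢ = (x)ᵢ + i (x)ᵢ₋₁ for the falling factorials (x)ᵢ.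
    φ-binomial : ∀ i c → φ i (λ k → binomial k c) ≈ u i c + ρ i * prev i c
    φ-binomial zero c = trans (ι-0C c) (sym (trans (+-congˡ (zeroʳ _)) (+-identityʳ _)))
      where
      ι-0C : ∀ c → ι (0 C c) ≈ δ 0 c
      ι-0C zero    = ι-1
      ι-0C (suc c) = trans (reflexive (≡.cong ι (k>n⇒nCk≡0 {0} {suc c} (s≤s z≤n)))) ι-0
    φ-binomial (suc i) c = begin
      κ * (φ i (λ k → binomial (suc k) c) + m * φ i (λ k → binomial k c))
        -- Pascal's rule expands (x + 1) ^ (k + 1) as (x + 1) ^ k plus x times it; the induction
        -- hypothesis applies to each summand.
        ≈⟨ *-congˡ (+-cong (trans (φ-cong i (λ k → binomial-suc k c)) (trans (φ-+ i _ _)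
             (+-cong (φ-binomial i c) (φ-delay c)))) (*-congˡ (φ-binomial i c))) ⟩
      κ * ((x + r * q) + (d + r * d′) + m * (x + r * q))
        ≈⟨ solve 7 (λ κ x r q d d′ m → κ :* ((x :+ r :* q) :+ (d :+ r :* d′) :+ m :* (x :+ r :* q)) :=
             κ :* ((x :+ d :+ m :* x) :+ r :* (q :+ d′ :+ m :* q))) refl κ x r q d d′ m ⟩
      κ * ((x + d + m * x) + r * (q + d′ + m * q))
        ≈⟨ *-congˡ (+-congˡ (ρ-prev i c)) ⟩
      κ * ((x + d + m * x) + ι i * x)
        ≈⟨ solve 5 (λ κ x d y z → κ :* ((x :+ d :+ y) :+ z) := κ :* (d :+ y) :+ (x :+ z) :* κ) refl
             κ x d (m * x) (ι i * x) ⟩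
      u (suc i) c + (x + ι i * x) * κ
        ≈⟨ +-congˡ (*-congʳ (ι-suc i x)) ⟨
      u (suc i) c + ι (suc i) * x * κ
        ≈⟨ +-congˡ (solve 3 (λ a x κ → a :* x :* κ := a :* κ :* x) refl (ι (suc i)) x κ) ⟩
      u (suc i) c + ρ (suc i) * x ∎
      where
      κ m x r q d d′ : Carrier
      κ  = kap (suc i)
      m  = - ι i
      x  = u i c
      r  = ρ i
      q  = prev i c
      d  = delay (u i) c
      d′ = delay (prev i) c
      φ-delay : ∀ c → φ i (λ k → delay (binomial k) c) ≈ delay (u i) c + ρ i * delay (prev i) c
      φ-delay zero    = trans (φ-0 i) (sym (trans (+-congˡ (zeroʳ _)) (+-identityʳ 0#)))
      φ-delay (suc c) = φ-binomial i c

    Uₘ Vₘ Bₘ : ∀ {n} → Matrix n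
    Uₘ i j = u (toℕ i) (toℕ j)
    Vₘ i j = v (toℕ i) (toℕ j)
    Bₘ i j = binomial (toℕ i) (toℕ j)

    Uₘ-· : ∀ {n} w i → (Uₘ {n} · w ∘ toℕ) i ≈ φ (toℕ i) w
    Uₘ-· {n} w i = trans (reflexive (sum≡Σ n (λ k → u (toℕ i) k * w k))) (Σ-u (toℕ i) w (Fin.toℕ<n i))

    Vₘ-· : ∀ {n} w i → (Vₘ {n} · w ∘ toℕ) i ≈ ψ (toℕ i) w
    Vₘ-· {n} w i = trans (reflexive (sum≡Σ n (λ k → v (toℕ i) k * w k))) (Σ-v (toℕ i) w (Fin.toℕ<n i))

    Uₘ*Vₘ : ∀ {n} → Uₘ {n} *ₘ Vₘ ≈ₘ 1ₘ
    Uₘ*Vₘ i j = trans (Uₘ-· (λ k → v k (toℕ j)) i) (trans (φ-v (toℕ i) (toℕ j)) (sym (1ₘ-δ i j)))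

    Vₘ*Uₘ : ∀ {n} → Vₘ {n} *ₘ Uₘ ≈ₘ 1ₘ
    Vₘ*Uₘ i j = trans (Vₘ-· (λ k → u k (toℕ j)) i) (trans (ψ-u (toℕ i) (toℕ j)) (sym (1ₘ-δ i j)))

    module _ {p : ℕ} .{{_ : NonZero p}}
             (ρ-multiple : ∀ i → p ∣ i → ρ i ≈ 0#) (ρ-coprime : ∀ i → ¬ p ∣ i → ρ i ≈ 1#) where

      -- The columns of U satisfy J U = U B, where B is the binomial matrix; multiplying by V on the
      -- left gives V J U = B.
      binomial-similar : ∀ q {r} → r ≤ p → Similar (Bₘ {dim (blocks p q r)}) (jordanMatrix (blocks p q r))
      binomial-similar q {r} r≤p = record
        { S = Vₘ ; S⁻¹ = Uₘ ; inverseʳ = Vₘ*Uₘ ; inverseˡ = Uₘ*Vₘ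
        ; similar = λ i c → sym (begin
            ((Vₘ *ₘ J) · col Uₘ c) i    ≈⟨ *ₘ-· Vₘ J (col Uₘ c) i ⟩
            (Vₘ · J · col Uₘ c) i       ≈⟨ ·-linear Vₘ .Linear.cong (intertwine c) i ⟩
            (Vₘ · Uₘ · col Bₘ c) i      ≈⟨ *ₘ-· Vₘ Uₘ (col Bₘ c) i ⟨
            ((Vₘ *ₘ Uₘ) · col Bₘ c) i   ≈⟨ ·-congʳ Vₘ*Uₘ (col Bₘ c) i ⟩
            (1ₘ · col Bₘ c) i           ≈⟨ 1ₘ-· (col Bₘ c) i ⟩
            Bₘ i c                      ∎)
        }
        where
        J = jordanMatrix (blocks p q r)
        col : ∀ {n} → Matrix n → Fin n → V n
        col A c k = A k c
        intertwine : ∀ c → J · col Uₘ c ≋ Uₘ · col Bₘ c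
        intertwine c i = begin
          (J · col Uₘ c) i
            ≈⟨ unipotent-· (blocks-unipotent p q r) (col Uₘ c) i ⟩
          u (toℕ i) (toℕ c) + nilpotent (blocks p q r) (col Uₘ c) i
            ≈⟨ +-congˡ (nilpotent-blocks p q r≤p (λ k → u k (toℕ c)) (λ k → ρ k * prev k (toℕ c))
                 (λ k p∣k → trans (*-congʳ (ρ-multiple k p∣k)) (zeroˡ _))
                 (λ k p∤k → trans (*-congʳ (ρ-coprime (suc k) p∤k)) (*-identityˡ _)) i) ⟩
          u (toℕ i) (toℕ c) + ρ (toℕ i) * prev (toℕ i) (toℕ c)
            ≈⟨ φ-binomial (toℕ i) (toℕ c) ⟨
          φ (toℕ i) (λ k → binomial k (toℕ c))
            ≈⟨ Uₘ-· (λ k → binomial k (toℕ c)) i ⟨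
          (Uₘ · col Bₘ c) i ∎

-- The field of residues modulo a prime.

module Residues (p : ℕ) where

  open CommutativeRing (ℤ/ p) hiding (zero)
  open LinearAlgebra (ℤ/ p)
  open JordanForm (ℤ/ p)

  ∣⇒≈0 : ∀ {n} → p ∣ n → + n ≈ 0#
  ∣⇒≈0 {n} p∣n = mod-eq (∣ᵤ⇒∣ (≡.subst (p ∣_) (≡.cong ℤ.∣_∣ (≡.sym (ℤ.+-identityʳ (+ n)))) p∣n))

  -- The inverse is the Bézout coefficient of n, with a sign that depends on which of the two
  -- subtraction-free forms of the identity holds.
  prime∤⇒unit : Prime p → ∀ {n} → ¬ p ∣ n → ∃ λ y → + n * y ≈ 1#
  prime∤⇒unit pp {n} p∤n with coprime-Bézout coprime
    where
    coprime : Coprime n p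
    coprime (d∣n , d∣p) with prime⇒irreducible pp d∣p
    ... | inj₁ d≡1    = d≡1
    ... | inj₂ ≡.refl = contradiction d∣n p∤n
  ... | Bézout.+- x y 1+yp≡xn = + x , mod-eq (divides (+ y) (begin
    + n ℤ.* + x ℤ.- 1ℤ                ≡⟨ ≡.cong (ℤ._- 1ℤ) (≡.trans (≡.sym (ℤ.pos-* n x)) (≡.cong +_ (≡.trans (ℕ.*-comm n x) (≡.sym 1+yp≡xn)))) ⟩
    + (1 ℕ.+ y ℕ.* p) ℤ.- 1ℤ          ≡⟨ ≡.cong (ℤ._- 1ℤ) (≡.trans (ℤ.pos-+ 1 _) (≡.cong (λ z → 1ℤ ℤ.+ z) (ℤ.pos-* y p))) ⟩
    1ℤ ℤ.+ + y ℤ.* + p ℤ.- 1ℤ         ≡⟨ eq (+ y) (+ p) ⟩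
    + y ℤ.* + p                       ∎))
    where
    open ≡.≡-Reasoning
    eq : ∀ y p → 1ℤ ℤ.+ y ℤ.* p ℤ.- 1ℤ ≡ y ℤ.* p
    eq = solve-∀
  ... | Bézout.-+ x y 1+xn≡yp = ℤ.- + x , mod-eq (divides (ℤ.- + y) (begin
    + n ℤ.* (ℤ.- + x) ℤ.- 1ℤ          ≡⟨ eq (+ n) (+ x) ⟩
    ℤ.- (1ℤ ℤ.+ + x ℤ.* + n)          ≡⟨ ≡.cong (λ z → ℤ.- z) (≡.trans (≡.cong (λ z → 1ℤ ℤ.+ z) (≡.sym (ℤ.pos-* x n))) (≡.sym (ℤ.pos-+ 1 _))) ⟩
    ℤ.- + (1 ℕ.+ x ℕ.* n)             ≡⟨ ≡.cong (λ m → ℤ.- + m) 1+xn≡yp ⟩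
    ℤ.- + (y ℕ.* p)                   ≡⟨ ≡.cong (λ z → ℤ.- z) (ℤ.pos-* y p) ⟩
    ℤ.- (+ y ℤ.* + p)                 ≡⟨ ℤ.neg-distribˡ-* (+ y) (+ p) ⟩
    ℤ.- + y ℤ.* + p                   ∎))
    where
    open ≡.≡-Reasoning
    eq : ∀ n x → n ℤ.* (ℤ.- x) ℤ.- 1ℤ ≡ ℤ.- (1ℤ ℤ.+ x ℤ.* n)
    eq = solve-∀

  ℕ-zeroOrUnit : Prime p → ∀ n → + n ≈ 0# ⊎ ∃ λ y → + n * y ≈ 1#
  ℕ-zeroOrUnit pp n with p ∣? n
  ... | yes p∣n = inj₁ (∣⇒≈0 p∣n)
  ... | no  p∤n = inj₂ (prime∤⇒unit pp p∤n)

  ℤ/p-isField : Prime p → IsField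
  ℤ/p-isField pp = record { 1≉0 = 1≉0 ; zeroOrUnit = zeroOrUnit }
    where
    1≉0 : ¬ 1# ≈ 0#
    1≉0 (mod-eq p∣1) = ¬prime[1] (≡.subst Prime (∣1⇒≡1 (∣⇒∣ᵤ p∣1)) pp)
    zeroOrUnit : ∀ x → x ≈ 0# ⊎ ∃ λ y → x * y ≈ 1#
    zeroOrUnit (+ n)    = ℕ-zeroOrUnit pp n
    zeroOrUnit -[1+ n ] with ℕ-zeroOrUnit pp (suc n)
    ... | inj₁ n≈0        = inj₁ (-‿cong n≈0)
    ... | inj₂ (y , unit) = inj₂ (- y , trans (mod-reflexive (eq (+ suc n) y)) unit)
      where
      eq : ∀ x y → (ℤ.- x) ℤ.* (ℤ.- y) ≡ x ℤ.* y
      eq = solve-∀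

-- Block counts as numbers.

module Counting {c ℓ} (R : CommutativeRing c ℓ) where

  open CommutativeRing R hiding (zero)
  open LinearAlgebra R
  open JordanForm R
  open Stirling R

  tops : ∀ j bs → ∃ (Tops j bs)
  tops j []       = 0 , []
  tops j (b ∷ bs) with j ℕ.<? size b | tops j bs
  ... | yes j<m | k , t = suc k , long j<m t
  ... | no  j≮m | k , t = k , short (ℕ.≮⇒≥ j≮m) t

  -- Block sizes are non-zero, so the threshold 0 counts every block.
  tops-0 : ∀ {bs k} → Tops 0 bs k → k ≡ length bs
  tops-0 []                 = ≡.refl
  tops-0 (long _ t)         = ≡.cong suc (tops-0 t)
  tops-0 (short {b} m≤0 t)  = contradiction (ℕ.n≤0⇒n≡0 m≤0) (ℕ.≢-nonZero⁻¹ (size b))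

  -- A block longer than j but not longer than j + 1 has size exactly j + 1.
  tops-count : ∀ {j bs k l} → Tops j bs k → Tops (suc j) bs l → k ≡ countOfSize (suc j) bs ℕ.+ l
  tops-count [] [] = ≡.refl
  tops-count {j} {b ∷ bs} (long j<m t) (long 1+j<m t′)
    rewrite List.filter-reject (λ b → size b ℕ.≟ suc j) {x = b} {xs = bs} (ℕ.>⇒≢ 1+j<m) =
    ≡.trans (≡.cong suc (tops-count t t′)) (≡.sym (ℕ.+-suc _ _))
  tops-count {j} {b ∷ bs} (long j<m t) (short m≤1+j t′)
    rewrite List.filter-accept (λ b → size b ℕ.≟ suc j) {x = b} {xs = bs} (ℕ.≤-antisym m≤1+j j<m) =
    ≡.cong suc (tops-count t t′)
  tops-count (short m≤j t) (long 1+j<m t′) = contradiction (ℕ.m<n⇒m<1+n (s≤s m≤j)) (ℕ.≤⇒≯ 1+j<m)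
  tops-count {j} {b ∷ bs} (short m≤j t) (short m≤1+j t′)
    rewrite List.filter-reject (λ b → size b ℕ.≟ suc j) {x = b} {xs = bs} (ℕ.<⇒≢ (s≤s m≤j)) =
    tops-count t t′

  -- With p = j + 1, the remainder block has size r < p and stays below the threshold, so only the q
  -- full blocks count.
  blocks-tops : ∀ j q {r} → r ≤ j → Tops j (blocks (suc j) q r) q
  blocks-tops j zero    {zero}  r≤j = []
  blocks-tops j zero    {suc r} r≤j = short r≤j []
  blocks-tops j (suc q)         r≤j = long ℕ.≤-refl (blocks-tops j q r≤j)

  blocks-tops-above : ∀ p .{{_ : NonZero p}} q {r} → r ≤ p → Tops p (blocks p q r) 0
  blocks-tops-above p       zero    {zero}  r≤p = []
  blocks-tops-above p       zero    {suc r} r≤p = short r≤p []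
  blocks-tops-above (suc p) (suc q)         r≤p = short ℕ.≤-refl (blocks-tops-above (suc p) q r≤p)

  length-blocks : ∀ j q {r} → r ≤ j → length (blocks (suc j) q r) ≡ ⌈ q ℕ.* suc j ℕ.+ r / suc j ⌉
  length-blocks j zero {zero}  r≤j = ≡.sym (m<n⇒m/n≡0 (ℕ.n<1+n j))
  length-blocks j zero {suc r} r≤j = ≡.sym (begin
    -- A non-zero remainder adds exactly one block: the ceiling of (r + 1) / p is 1 because r < p.
    suc (r ℕ.+ j) / suc j            ≡⟨ ≡.cong (_/ suc j) (ℕ.+-suc r j) ⟨
    (r ℕ.+ suc j) / suc j            ≡⟨ +-distrib-/-∣ʳ r ∣-refl ⟩
    r / suc j ℕ.+ suc j / suc j      ≡⟨ ≡.cong₂ ℕ._+_ (m<n⇒m/n≡0 (ℕ.m<n⇒m<1+n r≤j)) (n/n≡1 (suc j)) ⟩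
    1                                ∎)
    where open ≡.≡-Reasoning
  length-blocks j (suc q) {r} r≤j = begin
    suc (length (blocks (suc j) q r))                     ≡⟨ ≡.cong suc (length-blocks j q r≤j) ⟩
    1 ℕ.+ (q ℕ.* suc j ℕ.+ r ℕ.+ j) / suc j               ≡⟨ ≡.cong (ℕ._+ (q ℕ.* suc j ℕ.+ r ℕ.+ j) / suc j) (n/n≡1 (suc j)) ⟨
    suc j / suc j ℕ.+ (q ℕ.* suc j ℕ.+ r ℕ.+ j) / suc j   ≡⟨ +-distrib-/-∣ˡ (q ℕ.* suc j ℕ.+ r ℕ.+ j) ∣-refl ⟨
    (suc j ℕ.+ (q ℕ.* suc j ℕ.+ r ℕ.+ j)) / suc j         ≡⟨ ≡.cong (_/ suc j) (≡.trans (≡.cong (suc j ℕ.+_) (ℕ.+-assoc (q ℕ.* suc j) r j))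
                                                              (≡.trans (≡.sym (ℕ.+-assoc (suc j) (q ℕ.* suc j) (r ℕ.+ j))) (≡.sym (ℕ.+-assoc (suc j ℕ.+ q ℕ.* suc j) r j)))) ⟩
    (suc j ℕ.+ q ℕ.* suc j ℕ.+ r ℕ.+ j) / suc j           ∎
    where open ≡.≡-Reasoning

quotient-remainder : ∀ n p .{{_ : NonZero p}} → n / p ℕ.* p ℕ.+ n % p ≡ n
quotient-remainder n p = ≡.trans (ℕ.+-comm (n / p ℕ.* p) (n % p)) (≡.sym (m≡m%n+[m/n]*n n p))

-- The Jordan form of the Pascal matrix modulo p.

module _ (p : ℕ) where

  open CommutativeRing (ℤ/ p)
  open LinearAlgebra (ℤ/ p)
  open JordanForm (ℤ/ p)
  open Stirling (ℤ/ p)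

  pascal-similar : .{{_ : NonZero p}} → Prime p → ∀ q {r} → r ≤ p →
                   Similar (pascal (dim (blocks p q r))) (jordanMatrix (blocks p q r))
  pascal-similar pp = binomial-similar scaling ρ-multiple ρ-coprime
    where
    -- If p divides i, both units are 1, which keeps the change of basis invertible; the product of
    -- i and `kap i` is then still zero modulo p.
    inv : ∀ i → ∃ λ l → ∃ λ k → k * l ≈ 1# × (¬ p ∣ i → + i * k ≈ 1#)
    inv i with p ∣? i
    ... | yes p∣i = 1# , 1# , *-identityˡ 1# , contradiction p∣i
    ... | no  p∤i = let y , unit = Residues.prime∤⇒unit p pp p∤i in + i , y , trans (*-comm y (+ i)) unit , λ _ → unit
    lam kap : ℕ → Carrier
    lam i = proj₁ (inv i)
    kap i = proj₁ (proj₂ (inv i))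
    scaling : Stirling.Scaling (ℤ/ p) +_ lam kap
    scaling = record
      { ι-0 = refl ; ι-1 = refl ; ι-+ = λ m n → reflexive (ℤ.pos-+ m n)
      ; inverse = λ i → proj₁ (proj₂ (proj₂ (inv i))) }
    ρ-multiple : ∀ i → p ∣ i → + i * kap i ≈ 0#
    ρ-multiple i p∣i = trans (*-congʳ (Residues.∣⇒≈0 p p∣i)) (zeroˡ (kap i))
    ρ-coprime : ∀ i → ¬ p ∣ i → + i * kap i ≈ 1#
    ρ-coprime i = proj₂ (proj₂ (proj₂ (inv i)))

  pascal-jordanForm : .{{_ : NonZero p}} → Prime p → ∀ n → IsJordanForm (pascal n) (blocks p (n / p) (n % p))
  pascal-jordanForm pp n = isJordanForm (blocks p (n / p) (n % p))
    (≡.trans (dim-blocks p (n / p) (n % p)) (quotient-remainder n p))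
    (pascal-similar pp (n / p) (m%n≤n n p))
    where
    -- With the size generalised to a variable, the dimension equation can be matched with `refl`,
    -- which removes the `subst`.
    isJordanForm : ∀ {n} bs → dim bs ≡ n → Similar (pascal (dim bs)) (jordanMatrix bs) →
                   IsJordanForm (pascal n) bs
    isJordanForm bs ≡.refl sim = ≡.refl , sim

theorem1 : (n p : ℕ) .{{_ : NonZero p}} → n ≥ 1 → Prime p →
    let open CommutativeRing (ℤ/ p)
        open JordanForm (ℤ/ p)
    in ∃ (IsJordanForm (pascal n))
       × (∀ bs → IsJordanForm (pascal n) bs →
            length bs ≡ ⌈ n / p ⌉
            × All (λ b → eigenvalue b ≈ 1#) bs
            × countOfSize p bs ≡ n / p)
theorem1 n p@(suc j) n≥1 pp = (bs₀ , jordan₀) , λ bs jordan →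
  length-bs bs jordan , unipotent bs jordan , count-bs bs jordan
  where
  open ≡.≡-Reasoning
  open CommutativeRing (ℤ/ p) using (_≈_; 1#)
  open LinearAlgebra (ℤ/ p)
  open JordanForm (ℤ/ p)
  open Stirling (ℤ/ p)
  open Counting (ℤ/ p)

  𝔽ₚ : IsField
  𝔽ₚ = Residues.ℤ/p-isField p pp

  n%p≤j : n % p ≤ j
  n%p≤j = ℕ.s≤s⁻¹ (m%n<n n p)

  bs₀ : List Block
  bs₀ = blocks p (n / p) (n % p)

  jordan₀ : IsJordanForm (pascal n) bs₀
  jordan₀ = pascal-jordanForm p pp n

  unipotent₀ : Unipotent bs₀
  unipotent₀ = blocks-unipotent p (n / p) (n % p)

  module _ (bs : List Block) (jordan : IsJordanForm (pascal n) bs) where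

    -- Any Jordan form is compared with the explicit one through the Pascal matrix, to which both
    -- are conjugate.
    J∼J₀ : jordanMatrix bs ∼ jordanMatrix bs₀
    J∼J₀ = ∼-trans (isJordanForm⇒∼ bs jordan) (∼-sym (isJordanForm⇒∼ bs₀ jordan₀))

    unipotent : Unipotent bs
    unipotent = unipotent-∼ 𝔽ₚ {bs} {bs₀} J∼J₀ unipotent₀

    unique : ∀ {i k k₀} → Tops i bs k → Tops i bs₀ k₀ → k ≡ k₀
    unique = tops-unique 𝔽ₚ J∼J₀ unipotent unipotent₀

    length-bs : length bs ≡ ⌈ n / p ⌉
    length-bs = begin
      length bs                          ≡⟨ tops-0 (proj₂ (tops 0 bs)) ⟨
      proj₁ (tops 0 bs)                  ≡⟨ unique (proj₂ (tops 0 bs)) (proj₂ (tops 0 bs₀)) ⟩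
      proj₁ (tops 0 bs₀)                 ≡⟨ tops-0 (proj₂ (tops 0 bs₀)) ⟩
      length bs₀                         ≡⟨ length-blocks j (n / p) n%p≤j ⟩
      ⌈ (n / p ℕ.* p ℕ.+ n % p) / p ⌉      ≡⟨ ≡.cong (λ m → ⌈ m / p ⌉) (quotient-remainder n p) ⟩
      ⌈ n / p ⌉                          ∎

    count-bs : countOfSize p bs ≡ n / p
    count-bs = begin
      countOfSize p bs                          ≡⟨ ℕ.+-identityʳ _ ⟨
      -- No block of `bs₀` is longer than p, hence none of `bs` is; the blocks of `bs` longer than p
      -- - 1 are then exactly those of size p.
      countOfSize p bs ℕ.+ 0                    ≡⟨ ≡.cong (countOfSize p bs ℕ.+_) (unique (proj₂ (tops p bs)) (blocks-tops-above p (n / p) (m%n≤n n p))) ⟨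
      countOfSize p bs ℕ.+ proj₁ (tops p bs)    ≡⟨ tops-count (proj₂ (tops j bs)) (proj₂ (tops p bs)) ⟨
      proj₁ (tops j bs)                         ≡⟨ unique (proj₂ (tops j bs)) (blocks-tops j (n / p) n%p≤j) ⟩
      n / p                                     ∎
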